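{- Let $q$ be a prime power, $m$ a positive integer, and let $D\subseteq\mathbb{F}_{q^m}^*$ be an $\mathbb{F}_q^*$-invariant partial difference set with parameters $(q^m,k,\lambda,\mu)$. Let $\theta_1>0>\theta_2$ be the two restricted eigenvalues of $\mathrm{Cay}(\mathbb{F}_{q^m},D)$ and $\theta_0=\max\{|\theta_1|,|\theta_2|\}$. Suppose that (1) $k-\theta_2\neq q^m$; (2) $k>\theta_1$ and $k>-(q-1)\theta_2$; and at least one of the following holds: (3a) $k<q^m+q\theta_2-(q-1)\theta_1$; (3b) $k>\max\{q\theta_0+\theta_1,\ q\theta_0-(q-1)\theta_2\}$; (3c) $q^{m-1}+\theta_2-\theta_1>\theta_0$. Then the code $\mathcal C(M_D)$ is minimal.
   Context: $\mathrm{Tr}=\mathrm{Tr}_{\mathbb{F}_{q^m}/\mathbb{F}_q}$. A subset $D$ is $\mathbb{F}_q^*$-invariant if $\lambda d\in D$ for all $\lambda\in\mathbb{F}_q^*$, $d\in D$. A strongly regular graph $(v,k,\lambda,\mu)$ is a simple undirected graph, neither complete nor edgeless, which is $k$-regular on $v$ vertices, in which any two adjacent vertices have exactly $\lambda$ common neighbours and any two nonadjacent vertices have exactly $\mu$ common neighbours. For $D\subseteq\mathbb{F}_{q^m}^*$ with $-D=D$, the Cayley graph $\mathrm{Cay}(\mathbb{F}_{q^m},D)$ has vertex set $\mathbb{F}_{q^m}$, with $x\sim y$ iff $x-y\in D$; $D$ is a partial difference set with parameters $(v,k,\lambda,\mu)$ if this graph is strongly regular with these parameters (then $k=|D|$).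 An eigenvalue of the adjacency matrix is restricted if it has an eigenvector orthogonal to the all-one vector; a strongly regular graph has exactly two restricted eigenvalues $\theta_1>0>\theta_2$, and for a partial difference set $D$ one has $\sum_{d\in D}\Psi(ad)\in\{\theta_1,\theta_2\}$ for every $a\in\mathbb{F}_{q^m}^*$, where $\Psi(x)=\zeta_p^{\mathrm{Tr}_{\mathbb{F}_{q^m}/\mathbb{F}_p}(x)}$ is the canonical additive character ($p$ the characteristic, $\zeta_p=e^{2\pi i/p}$). Code: fix an ordering $x_1,\dots,x_{q^m-1}$ of $\mathbb{F}_{q^m}^*$, let $f_D$ be the characteristic function of $D$ with values in $\{0,1\}\subseteq\mathbb{F}_q$, and for $(u,v)\in\mathbb{F}_q\times\mathbb{F}_{q^m}$ put $c(u,v)=(uf_D(x_i)+\mathrm{Tr}(vx_i))_{1\le i\le q^m-1}$; $\mathcal C(M_D)=\{c(u,v)\}$. A linear code is minimal if whenever codewords $c,c'$ satisfy $\mathrm{supp}(c')\subseteq\mathrm{supp}(c)$ (supports = sets of nonzero coordinates) then $c'=\lambda c$ for some $\lambda\in\mathbb{F}_q$. -}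

module Defs where

open import Data.Nat as ℕ using (ℕ; zero; suc; _^_)
open import Data.Integer as ℤ using (ℤ; +_; ∣_∣)
open import Data.Bool using (Bool; true; false; _∧_; not)
open import Data.Fin using (Fin)
open import Data.List using (List; map; filter; length; foldr; allFin; upTo)
open import Data.Product using (Σ; ∃; ∃-syntax; _×_; _,_)
open import Relation.Nullary using (¬_)
open import Relation.Binary.PropositionalEquality using (_≡_; _≢_)
open import Algebra.Structures using (IsCommutativeRing)
open import Function.Bundles using (_↔_; Inverse)
open import Data.Bool.Properties using (T?)

record FiniteField : Set₁ where
  field
    Carrier : Set
    _+_ _*_ : Carrier → Carrier → Carrier
    -_      : Carrier → Carrier
    0# 1#   : Carrier
    isCommutativeRing : IsCommutativeRing _≡_ _+_ _*_ -_ 0# 1#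
    0≢1     : 0# ≢ 1#
    inverse : ∀ x → x ≢ 0# → ∃[ y ] (x * y ≡ 1#)
    size    : ℕ
    enum    : Fin size ↔ Carrier

module FF (K : FiniteField) where
  open FiniteField K

  elems : List Carrier
  elems = map (Inverse.to enum) (allFin size)

  ∑ℤ : (Carrier → ℤ) → ℤ
  ∑ℤ g = foldr (λ x acc → g x ℤ.+ acc) (+ 0) elems

  count : (Carrier → Bool) → ℕ
  count P = length (filter (λ x → T? (P x)) elems)

  pow : Carrier → ℕ → Carrier
  pow x zero    = 1#
  pow x (suc n) = x * pow x n

  ∑F : List Carrier → Carrier
  ∑F = foldr _+_ 0#

  -- Viewing K as F_{q^m}:  the subfield F_q = { x | x^q = x }
  InFq : ℕ → Carrier → Set
  InFq q x = pow x q ≡ x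

  Tr : ℕ → ℕ → Carrier → Carrier
  Tr q m x = ∑F (map (λ i → pow x (q ^ i)) (upTo m))

  Subset : Set
  Subset = Carrier → Bool

  adj : Subset → Carrier → Carrier → Bool
  adj D x y = D (x + (- y))

  ZeroFreeSymmetric : Subset → Set
  ZeroFreeSymmetric D = (D 0# ≡ false) × (∀ x → D (- x) ≡ D x)

  FqInvariant : ℕ → Subset → Set
  FqInvariant q D = ∀ l d → InFq q l → l ≢ 0# → D d ≡ true → D (l * d) ≡ true

  record IsSRG (A : Carrier → Carrier → Bool) (v k λ' μ : ℕ) : Set where
    field
      order        : size ≡ v
      notComplete  : ∃[ x ] ∃[ y ] (x ≢ y × A x y ≡ false)
      notEdgeless  : ∃[ x ] ∃[ y ] (A x y ≡ true)
      regular      : ∀ x → count (A x) ≡ k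
      adjacentCommon    : ∀ x y → x ≢ y → A x y ≡ true →
                          count (λ z → A x z ∧ A y z) ≡ λ'
      nonadjacentCommon : ∀ x y → x ≢ y → A x y ≡ false →
                          count (λ z → A x z ∧ A y z) ≡ μ

  IsPDS : Subset → ℕ → ℕ → ℕ → ℕ → Set
  IsPDS D v k λ' μ = ZeroFreeSymmetric D × IsSRG (adj D) v k λ' μ

  ind : Bool → ℤ
  ind true  = + 1
  ind false = + 0

  RestrictedEigenvalue : Subset → ℤ → Set
  RestrictedEigenvalue D θ =
    ∃[ f ] ((∃[ x ] (f x ≢ + 0))
           × ∑ℤ f ≡ + 0
           × (∀ x → ∑ℤ (λ y → ind (adj D x y) ℤ.* f y) ≡ θ ℤ.* f x))

  fD : Subset → Carrier → Carrier
  fD D x with D x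
  ... | true  = 1#
  ... | false = 0#

  -- codeword c(u,v), coordinates indexed by the nonzero elements x of K
  cw : ℕ → ℕ → Subset → Carrier → Carrier → Carrier → Carrier
  cw q m D u v x = (u * fD D x) + Tr q m (v * x)

  IsCodeword : ℕ → ℕ → Subset → (Carrier → Carrier) → Set
  IsCodeword q m D c = ∃[ u ] ∃[ v ] (InFq q u × (∀ x → x ≢ 0# → c x ≡ cw q m D u v x))

  SuppSub : (Carrier → Carrier) → (Carrier → Carrier) → Set
  SuppSub c' c = ∀ x → x ≢ 0# → c' x ≢ 0# → c x ≢ 0#

  IsMinimalCode : ℕ → ℕ → Subset → Set
  IsMinimalCode q m D = ∀ c c' → IsCodeword q m D c → IsCodeword q m D c' →
    SuppSub c' c → ∃[ l ] (InFq q l × (∀ x → x ≢ 0# → c' x ≡ l * c x))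

maxℤ : ℤ → ℤ → ℤ
maxℤ = ℤ._⊔_

absℤ : ℤ → ℤ
absℤ z = + ∣ z ∣

{-# OPTIONS --safe #-}

-- The sum χ_v of the character Ψ(v·) over D is k − q M_v, where M_v counts the d ∈ D with Tr(vd) = 1: the fibres of
-- d ↦ Tr(vd) over F_q^* have equal size because D is F_q^*-invariant. It is an eigenvalue with the integral eigenvector
-- q·1_H − 1, H being the hyperplane Tr(vx) = 0, so χ_v ∈ {θ₁, θ₂}.
--
-- Let c(u′,v′) be not proportional to c(u,v), with supp c(u′,v′) ⊆ supp c(u,v). If u ≠ 0, subtracting a multiple of c(u,v) gives u′ = 0. The support
-- condition then forces H_v \ H_v′ ⊆ D ⊆ H_v ∪ H_v′ for independent v, v′; comparing D ∩ H_v with D ∩ H_{v′+v} yields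
-- q^(m−1) = θ₁ − θ₂ and k ≤ θ₁ − qθ₂, which each of (3a), (3b), (3c) excludes. If u = 0, then D ∩ H_v = H_v \ H_v′ and
-- q = 2, hence k = q^(m−1) − χ_v and q^(m−1) ≤ −2θ₂, again excluded. The dependent cases are excluded by (1) and (2).
module Submission where

open import Defs
open import Algebra.Bundles using (CommutativeMonoid; CommutativeRing)
import Algebra.Properties.CommutativeMonoid.Sum as CommutativeMonoidSum
import Algebra.Properties.CommutativeSemiring.Binomial as Binomial
import Algebra.Properties.CommutativeSemiring.Exp as Exp
import Algebra.Properties.Group as GroupProperties
import Algebra.Properties.Monoid.Mult as MonoidMult
import Algebra.Properties.Ring as RingProperties
import Algebra.Properties.Semiring.Mult as SemiringMult
import Algebra.Properties.Semiring.Sum as SemiringSum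
import Algebra.Solver.Ring.NaturalCoefficients.Default as NaturalSolver
open import Data.Bool using (true; false; _∧_)
open import Data.Bool.Properties using (T?)
open import Data.Empty using (⊥; ⊥-elim)
open import Data.Fin.Base using (Fin; zero; suc; punchIn; toℕ; inject₁; fromℕ)
open import Data.Fin.Permutation using (Permutation; permutation)
open import Data.Fin.Properties using (inj⇒≟; punchInᵢ≢i; any?; toℕ-inject₁; toℕ-fromℕ; toℕ<n)
open import Data.Integer as ℤ using (ℤ; +_; -[1+_]; _+_; _-_; _*_; -_; _<_; _≤_; +≤+)
import Data.Integer.Properties as ℤₚ
open import Data.Integer.Tactic.RingSolver using (solve-∀)
open import Data.List.Base using ([]; _∷_; foldr; filter; length; tabulate; applyUpTo)
open import Data.List.Properties using (map-tabulate; map-upTo)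
open import Data.Nat as ℕ using (ℕ; zero; suc; z≤n; s≤s; _^_; _≥_; _∸_; _!; NonZero)
open import Data.Nat.Combinatorics using (_C_; nCk≡n!/k![n-k]!; k![n∸k]!∣n!; nCn≡1)
open import Data.Nat.DivMod using (m/n*n≡m)
open import Data.Nat.Divisibility using (_∣_; divides; ∣⇒≤; m∣m*n)
open import Data.Nat.Primality using (Prime; euclidsLemma; prime⇒nonTrivial; prime⇒nonZero)
import Data.Nat.Properties as ℕₚ
open import Data.Product using (_×_; _,_; ∃-syntax; proj₁; proj₂)
open import Data.Sum using (_⊎_; inj₁; inj₂; [_,_]′)
open import Data.Vec.Base using (Vec; []; _∷_)
open import Function.Base using (_∘_; id)
open import Function.Bundles using (Inverse)
open import Function.Properties.Inverse using (↔-sym; Inverse⇒Injection)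
open import Level using (0ℓ)
open import Relation.Binary.Definitions using (DecidableEquality)
open import Relation.Binary.PropositionalEquality
open import Relation.Nullary using (Dec; yes; no; ¬_)

-- Sums over the field

-- The field is known only through its axioms and its size, so what is needed of the trace is
-- obtained by counting roots. The polynomial Tr(x) - t has at most q^(m-1) roots and x^q - x at
-- most q, while the q^m elements of K all lie in fibres over F_q. Hence both bounds are attained:
-- F_q has q elements, the fibres are equally large, and all hyperplane sizes follow. Complex
-- characters never enter. Invariance of D makes each character sum an integer, and strong
-- regularity makes every restricted eigenvalue a root of one integral quadratic; having two roots
-- already, it admits no third value. The code conditions are containments between D and
-- hyperplanes, which control |D ∩ H_v|. The relation (q-1)χ_v = q|D ∩ H_v| - k translates such
-- counts into linear relations between k, q^(m-1), θ₁ and θ₂. That χ_v takes only two values is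
-- what makes these relations rigid enough to contradict the numerical hypotheses.

module FiniteSums (K : FiniteField) where
  open FiniteField K using (Carrier; size; enum)
  open FF K using (∑ℤ; elems; count; ind)

  private
    to : Fin size → Carrier
    to = Inverse.to enum
    from : Carrier → Fin size
    from = Inverse.from enum
    to∘from : ∀ x → to (from x) ≡ x
    to∘from x = Inverse.inverseˡ enum refl
    from∘to : ∀ i → from (to i) ≡ i
    from∘to i = Inverse.inverseʳ enum refl

  infix 4 _≟_
  opaque
    _≟_ : DecidableEquality Carrier
    _≟_ = inj⇒≟ (Inverse⇒Injection (↔-sym enum))

  -- General monoids, because three are used: the integers for counting, the additive monoid of K
  -- for its characteristic, and the multiplicative one for Fermat's identity.
  module MonoidSum (M : CommutativeMonoid 0ℓ 0ℓ) where
    open CommutativeMonoid M renaming (Carrier to A; refl to ≈-refl; sym to ≈-sym; trans to ≈-trans)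
    private module S = CommutativeMonoidSum M
    open MonoidMult monoid using () renaming (_×_ to _·_)

    opaque
      ∑ : (Carrier → A) → A
      ∑ f = S.sum (f ∘ to)


    private
      sum-single : ∀ {n} (i : Fin n) (t : Fin n → A) → (∀ j → j ≢ i → t j ≈ ε) → S.sum t ≈ t i
      sum-single {suc n} i t z = ≈-trans (S.sum-remove t) (≈-trans (∙-cong ≈-refl
        (≈-trans (S.sum-cong-≋ (λ j → z (punchIn i j) (punchInᵢ≢i i j))) (S.sum-replicate-zero n)))
        (identityʳ (t i)))

    opaque
      unfolding ∑

      ∑-cong : ∀ {f g} → (∀ x → f x ≈ g x) → ∑ f ≈ ∑ g
      ∑-cong f≈g = S.sum-cong-≋ (f≈g ∘ to)

      ∑-distrib-∙ : ∀ f g → ∑ (λ x → f x ∙ g x) ≈ ∑ f ∙ ∑ g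
      ∑-distrib-∙ f g = S.∑-distrib-+ (f ∘ to) (g ∘ to)

      ∑-comm : ∀ (f : Carrier → Carrier → A) → ∑ (λ x → ∑ (f x)) ≈ ∑ (λ y → ∑ (λ x → f x y))
      ∑-comm f = S.∑-comm (λ i j → f (to i) (to j))

      ∑-const : ∀ a → ∑ (λ _ → a) ≈ size · a
      ∑-const a = S.sum-replicate size

      ∑-reindex : ∀ {f g : Carrier → Carrier} → (∀ x → f (g x) ≡ x) → (∀ x → g (f x) ≡ x) →
                  ∀ h → ∑ (h ∘ f) ≈ ∑ h
      ∑-reindex {f} {g} fg gf h = ≈-sym (≈-trans (S.sum-permute (h ∘ to) π)
        (S.sum-cong-≋ (λ i → reflexive (cong h (to∘from (f (to i)))))))
        where
        inverts : ∀ {a b : Carrier → Carrier} → (∀ x → a (b x) ≡ x) →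
                  ∀ i → from (a (to (from (b (to i))))) ≡ i
        inverts {a} {b} ab i = trans (cong (from ∘ a) (to∘from (b (to i)))) (trans (cong from (ab (to i))) (from∘to i))
        π : Permutation size size
        π = permutation (from ∘ f ∘ to) (from ∘ g ∘ to) (inverts {f} {g} fg) (inverts {g} {f} gf)

      ∑-closed : (P : A → Set) → P ε → (∀ {a b} → P a → P b → P (a ∙ b)) →
                 ∀ {f} → (∀ x → P (f x)) → P (∑ f)
      ∑-closed P Pε P∙ {f} Pf = go (f ∘ to) (Pf ∘ to)
        where
        go : ∀ {n} (t : Fin n → A) → (∀ i → P (t i)) → P (S.sum t)
        go {zero}  t Pt = Pε
        go {suc n} t Pt = P∙ (Pt zero) (go (t ∘ suc) (Pt ∘ suc))

      ∑-single : ∀ a (f : Carrier → A) → (∀ x → x ≢ a → f x ≈ ε) → ∑ f ≈ f a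
      ∑-single a f z = ≈-trans (sum-single (from a) (f ∘ to) zeros) (reflexive (cong f (to∘from a)))
        where
        zeros : ∀ j → j ≢ from a → f (to j) ≈ ε
        zeros j j≢ = z (to j) (λ e → j≢ (trans (sym (from∘to j)) (cong from e)))

  open MonoidSum ℤₚ.+-0-commutativeMonoid public
    renaming (∑-distrib-∙ to ∑-distrib-+) hiding (∑-const)
  private
    module S = SemiringSum (CommutativeRing.semiring ℤₚ.+-*-commutativeRing)

  opaque
    unfolding ∑

    ∑-*ˡ : ∀ c f → ∑ (λ x → c * f x) ≡ c * ∑ f
    ∑-*ˡ c f = sym (S.*-distribˡ-sum c (f ∘ to))

    ∑-distrib-- : ∀ f g → ∑ (λ x → f x - g x) ≡ ∑ f - ∑ g
    ∑-distrib-- f g = trans (∑-cong (λ x → minus (f x) (g x))) (trans (∑-distrib-+ f (λ x → - + 1 * g x))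
      (trans (cong (λ t → ∑ f + t) (∑-*ˡ (- + 1) g)) (sym (minus (∑ f) (∑ g)))))
      where
      minus : ∀ a b → a - b ≡ a + - + 1 * b
      minus = solve-∀

    ∑-const : ∀ c → ∑ (λ _ → c) ≡ + size * c
    ∑-const c = go size
      where
      go : ∀ n → S.sum {n} (λ _ → c) ≡ + n * c
      go zero    = sym (ℤₚ.*-zeroˡ c)
      go (suc n) = trans (cong (λ t → c + t) (go n)) (sym (ℤₚ.suc-* (+ n) c))

    ∑-mono : ∀ {f g} → (∀ x → f x ≤ g x) → ∑ f ≤ ∑ g
    ∑-mono f≤g = go (f≤g ∘ to)
      where
      go : ∀ {n} {s t : Fin n → ℤ} → (∀ i → s i ≤ t i) → S.sum s ≤ S.sum t
      go {zero}  s≤t = ℤₚ.≤-refl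
      go {suc n} s≤t = ℤₚ.+-mono-≤ (s≤t zero) (go (s≤t ∘ suc))

    elems≡ : elems ≡ tabulate to
    elems≡ = map-tabulate id to

    ∑ℤ≡∑ : ∀ f → ∑ℤ f ≡ ∑ f
    ∑ℤ≡∑ f = trans (cong (foldr _ (+ 0)) elems≡) (go to)
      where
      go : ∀ {n} (t : Fin n → Carrier) → foldr (λ x acc → f x + acc) (+ 0) (tabulate t) ≡ S.sum (f ∘ t)
      go {zero}  t = refl
      go {suc n} t = cong (λ s → f (t zero) + s) (go (t ∘ suc))

    count≡∑ : ∀ P → + count P ≡ ∑ (ind ∘ P)
    count≡∑ P = trans (go elems) (∑ℤ≡∑ (ind ∘ P))
      where
      go : ∀ xs → + length (filter (λ x → T? (P x)) xs) ≡ foldr (λ x acc → ind (P x) + acc) (+ 0) xs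
      go []       = refl
      go (x ∷ xs) with P x
      ... | true  = cong (λ t → + 1 + t) (go xs)
      ... | false = trans (go xs) (sym (ℤₚ.+-identityˡ _))

-- Finite fields: Frobenius, Fermat, number of roots

prime∤k! : ∀ {p} → Prime p → ∀ k → k ℕ.< p → ¬ p ∣ k !
prime∤k! {p} pp zero    k<p p∣ = ℕₚ.<⇒≱ (ℕ.nonTrivial⇒n>1 p {{prime⇒nonTrivial pp}}) (∣⇒≤ p∣)
prime∤k! {p} pp (suc k) k<p p∣ with euclidsLemma (suc k) (k !) pp p∣
... | inj₁ p∣1+k = ℕₚ.<⇒≱ k<p (∣⇒≤ p∣1+k)
... | inj₂ p∣k!  = prime∤k! pp k (ℕₚ.<-trans (ℕₚ.n<1+n k) k<p) p∣k!

-- The product of the coefficient with k! (p-k)! is p!, which p divides; both factorials are prime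
-- to p because k and p-k are less than p.
prime∣pCk : ∀ {p} → Prime p → ∀ k → 0 ℕ.< k → k ℕ.< p → p ∣ p C k
prime∣pCk {p@(suc p-1)} pp k 0<k k<p with euclidsLemma (p C k) d pp p∣pCk*d
  where
  d = k ! ℕ.* (p ∸ k) !
  instance
    d≢0 : NonZero d
    d≢0 = ℕₚ.m*n≢0 (k !) ((p ∸ k) !) {{ℕₚ._!≢0 k}} {{ℕₚ._!≢0 (p ∸ k)}}
  p∣pCk*d : p ∣ (p C k) ℕ.* d
  p∣pCk*d = subst (p ∣_) (sym (trans (cong (ℕ._* d) (nCk≡n!/k![n-k]! (ℕₚ.<⇒≤ k<p)))
    (m/n*n≡m (k![n∸k]!∣n! (ℕₚ.<⇒≤ k<p))))) (m∣m*n (p-1 !))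
... | inj₁ p∣C = p∣C
... | inj₂ p∣d with euclidsLemma (k !) ((p ∸ k) !) pp p∣d
... | inj₁ p∣k!     = ⊥-elim (prime∤k! pp k k<p p∣k!)
... | inj₂ p∣[p-k]! = ⊥-elim (prime∤k! pp (p ∸ k) (ℕₚ.∸-monoʳ-< 0<k (ℕₚ.<⇒≤ k<p)) p∣[p-k]!)

module FieldTheory (K : FiniteField) where
  open FiniteField K public using (Carrier; 0#; 1#; 0≢1; size; isCommutativeRing; inverse; enum)
    renaming (_+_ to infixl 6 _⊕_; _*_ to infixl 7 _⊗_; -_ to infix 8 ⊖_)
  open FF K public using (pow; InFq; Tr; ∑F)
  open FiniteSums K public

  R : CommutativeRing 0ℓ 0ℓ
  R = record { isCommutativeRing = isCommutativeRing }
  open CommutativeRing R public using (+-group; ring; semiring; commutativeSemiring;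
    +-commutativeMonoid; *-commutativeMonoid)
    renaming (+-identityˡ to ⊕-identityˡ; +-identityʳ to ⊕-identityʳ; +-comm to ⊕-comm; +-assoc to ⊕-assoc;
              *-identityˡ to ⊗-identityˡ; *-identityʳ to ⊗-identityʳ; *-comm to ⊗-comm; *-assoc to ⊗-assoc;
              zeroˡ to ⊗-zeroˡ; zeroʳ to ⊗-zeroʳ; distribˡ to ⊗-distribˡ; distribʳ to ⊗-distribʳ;
              -‿inverseˡ to ⊖-inverseˡ; -‿inverseʳ to ⊖-inverseʳ)
  open GroupProperties +-group public using ()
    renaming (∙-cancelˡ to ⊕-cancelˡ; ∙-cancelʳ to ⊕-cancelʳ; identityʳ-unique to ⊕-identityʳ-unique;
              inverseˡ-unique to ⊖-uniqueˡ; ⁻¹-involutive to ⊖-involutive; ε⁻¹≈ε to ⊖0≡0)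
  open RingProperties ring public using ()
    renaming (-‿distribˡ-* to ⊖-distribˡ-⊗; -‿distribʳ-* to ⊖-distribʳ-⊗)
  open NaturalSolver commutativeSemiring public using (solve; _:+_; _:*_; _:=_; con)
  open Exp commutativeSemiring using (^-distrib-*; ^-assocʳ) renaming (_^_ to _^ᴷ_)
  open SemiringMult semiring using (×1-homo-*; ×-assoc-*; ×-assocˡ) renaming (_×_ to _·_)

  ⊗-cancelˡ : ∀ x {y z} → x ≢ 0# → x ⊗ y ≡ x ⊗ z → y ≡ z
  ⊗-cancelˡ x {y} {z} x≢0 xy≡xz with x⁻¹ , xx⁻¹≡1 ← inverse x x≢0 =
    trans (undo y) (trans (cong (x⁻¹ ⊗_) xy≡xz) (sym (undo z)))
    where
    undo : ∀ w → w ≡ x⁻¹ ⊗ (x ⊗ w)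
    undo w = trans (trans (sym (⊗-identityˡ w)) (cong (_⊗ w) (sym xx⁻¹≡1)))
      (solve 3 (λ a b c → (a :* b) :* c := b :* (a :* c)) refl x x⁻¹ w)

  x⊗y≡0⇒y≡0 : ∀ {x y} → x ≢ 0# → x ⊗ y ≡ 0# → y ≡ 0#
  x⊗y≡0⇒y≡0 {x} x≢0 xy≡0 = ⊗-cancelˡ x x≢0 (trans xy≡0 (sym (⊗-zeroʳ x)))

  ⊗-nonzero : ∀ {x y} → x ≢ 0# → y ≢ 0# → x ⊗ y ≢ 0#
  ⊗-nonzero x≢0 y≢0 xy≡0 = y≢0 (x⊗y≡0⇒y≡0 x≢0 xy≡0)

  ⊕⊖-assoc : ∀ x y → x ⊕ y ⊕ ⊖ y ≡ x
  ⊕⊖-assoc x y = trans (⊕-assoc x y (⊖ y)) (trans (cong (x ⊕_) (⊖-inverseʳ y)) (⊕-identityʳ x))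

  ⊖⊕-assoc : ∀ x y → x ⊕ ⊖ y ⊕ y ≡ x
  ⊖⊕-assoc x y = trans (⊕-assoc x (⊖ y) y) (trans (cong (x ⊕_) (⊖-inverseˡ y)) (⊕-identityʳ x))

  opaque
    δ : Carrier → Carrier → ℤ
    δ x y with x ≟ y
    ... | yes _ = + 1
    ... | no  _ = + 0

    δ-cases : ∀ x y → (x ≡ y × δ x y ≡ + 1) ⊎ (x ≢ y × δ x y ≡ + 0)
    δ-cases x y with x ≟ y
    ... | yes x≡y = inj₁ (x≡y , refl)
    ... | no  x≢y = inj₂ (x≢y , refl)

  δ-≡ : ∀ {x y} → x ≡ y → δ x y ≡ + 1
  δ-≡ {x} {y} x≡y with δ-cases x y
  ... | inj₁ (_   , e) = e
  ... | inj₂ (x≢y , _) = ⊥-elim (x≢y x≡y)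

  δ-≢ : ∀ {x y} → x ≢ y → δ x y ≡ + 0
  δ-≢ {x} {y} x≢y with δ-cases x y
  ... | inj₁ (x≡y , _) = ⊥-elim (x≢y x≡y)
  ... | inj₂ (_   , e) = e

  δ-cong : ∀ {x y x′ y′} → (x ≡ y → x′ ≡ y′) → (x′ ≡ y′ → x ≡ y) → δ x y ≡ δ x′ y′
  δ-cong {x} {y} f g with δ-cases x y
  ... | inj₁ (x≡y , e) = trans e (sym (δ-≡ (f x≡y)))
  ... | inj₂ (x≢y , e) = trans e (sym (δ-≢ (x≢y ∘ g)))

  δ-≥0 : ∀ x y → + 0 ≤ δ x y
  δ-≥0 x y with δ-cases x y
  ... | inj₁ (_ , e) = subst (+ 0 ≤_) (sym e) (+≤+ z≤n)
  ... | inj₂ (_ , e) = subst (+ 0 ≤_) (sym e) ℤₚ.≤-refl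

  ∑-δˡ : ∀ a (f : Carrier → ℤ) → ∑ (λ x → δ x a * f x) ≡ f a
  ∑-δˡ a f = trans (∑-single a (λ x → δ x a * f x) (λ x x≢a → trans (cong (λ d → d * f x) (δ-≢ x≢a)) (ℤₚ.*-zeroˡ (f x))))
    (trans (cong (λ d → d * f a) (δ-≡ {a} refl)) (ℤₚ.*-identityˡ (f a)))

  ∑-δ : ∀ a → ∑ (λ x → δ x a) ≡ + 1
  ∑-δ a = trans (∑-single a (λ x → δ x a) (λ x x≢a → δ-≢ x≢a)) (δ-≡ {a} refl)

  pow≡^ : ∀ x n → pow x n ≡ x ^ᴷ n
  pow≡^ x zero    = refl
  pow≡^ x (suc n) = cong (x ⊗_) (pow≡^ x n)

  pow-distrib-⊗ : ∀ x y n → pow (x ⊗ y) n ≡ pow x n ⊗ pow y n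
  pow-distrib-⊗ x y n = trans (pow≡^ (x ⊗ y) n)
    (trans (^-distrib-* x y n) (sym (cong₂ _⊗_ (pow≡^ x n) (pow≡^ y n))))

  pow-pow : ∀ x m n → pow (pow x m) n ≡ pow x (m ℕ.* n)
  pow-pow x m n = trans (pow≡^ (pow x m) n) (trans (cong (_^ᴷ n) (pow≡^ x m))
    (trans (^-assocʳ x m n) (sym (pow≡^ x (m ℕ.* n)))))

  pow-suc-comm : ∀ x m n → pow x (m ^ suc n) ≡ pow (pow x (m ^ n)) m
  pow-suc-comm x m n = sym (trans (pow-pow x (m ^ n) m) (cong (pow x) (ℕₚ.*-comm (m ^ n) m)))

  pow-1# : ∀ n → pow 1# n ≡ 1#
  pow-1# zero    = refl
  pow-1# (suc n) = trans (⊗-identityˡ _) (pow-1# n)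

  pow-0# : ∀ n → .{{NonZero n}} → pow 0# n ≡ 0#
  pow-0# (suc n) = ⊗-zeroˡ _

  pow-nonzero : ∀ {x} n → x ≢ 0# → pow x n ≢ 0#
  pow-nonzero zero    x≢0 = λ 1≡0 → 0≢1 (sym 1≡0)
  pow-nonzero (suc n) x≢0 = ⊗-nonzero x≢0 (pow-nonzero n x≢0)

  private
    module Additive = MonoidSum +-commutativeMonoid
    module Multiplicative = MonoidSum *-commutativeMonoid

  -- x ↦ x + 1 permutes K, so the sum of all elements absorbs size · 1.
  size·1≡0 : size · 1# ≡ 0#
  size·1≡0 = trans (sym (Additive.∑-const 1#)) (⊕-identityʳ-unique (Additive.∑ id) _
    (trans (sym (Additive.∑-distrib-∙ id (λ _ → 1#)))
      (Additive.∑-reindex {λ x → x ⊕ 1#} {λ x → x ⊕ ⊖ 1#} (λ x → ⊖⊕-assoc x 1#) (λ x → ⊕⊖-assoc x 1#) id)))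

  -- Since a^n · 1 is the n-th power of a · 1 and a field has no zero divisors, the size q^m yields
  -- characteristic p.
  a^n·1≡0⇒a·1≡0 : ∀ a n → (a ^ n) · 1# ≡ 0# → a · 1# ≡ 0#
  a^n·1≡0⇒a·1≡0 a zero    e = ⊥-elim (0≢1 (sym (trans (sym (⊕-identityʳ 1#)) e)))
  a^n·1≡0⇒a·1≡0 a (suc n) e with (a · 1#) ≟ 0#
  ... | yes a≡0 = a≡0
  ... | no  a≢0 = a^n·1≡0⇒a·1≡0 a n (x⊗y≡0⇒y≡0 a≢0 (trans (sym (×1-homo-* a (a ^ n))) e))

  size≡⇒p·1≡0 : ∀ p e m → size ≡ (p ^ e) ^ m → p · 1# ≡ 0#
  size≡⇒p·1≡0 p e m size≡ =
    a^n·1≡0⇒a·1≡0 p e (a^n·1≡0⇒a·1≡0 (p ^ e) m (subst (λ s → s · 1# ≡ 0#) size≡ size·1≡0))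

  -- x ↦ ax permutes K, so the product of the nonzero elements absorbs a factor a for each of them.
  fermat : ∀ a → pow a size ≡ a
  fermat a with a ≟ 0#
  ... | yes refl = pow-0# size {{size≢0}}
    where
    size≢0 : NonZero size
    size≢0 with size in eq
    ... | zero  = ⊥-elim (noElement (Inverse.from enum 0#))
      where
      noElement : ¬ Fin size
      noElement i with () ← subst Fin eq i
    ... | suc _ = _
  ... | no a≢0 = trans (pow≡^ a size) (trans (sym (Multiplicative.∑-const a))
        (trans (Multiplicative.∑-cong (λ x → split x))
        (trans (Multiplicative.∑-distrib-∙ s t) (trans (cong₂ _⊗_ ∏s≡1 ∏t≡a) (⊗-identityˡ a)))))
    where
    -- The constant function a is s times t, where t carries the factor at zero and s the others.
    -- The function u is the identity with 0 replaced by 1, so that its product can be cancelled.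
    s t u : Carrier → Carrier
    s x with x ≟ 0#
    ... | yes _ = 1#
    ... | no  _ = a
    t x with x ≟ 0#
    ... | yes _ = a
    ... | no  _ = 1#
    u x with x ≟ 0#
    ... | yes _ = 1#
    ... | no  _ = x
    split : ∀ x → a ≡ s x ⊗ t x
    split x with x ≟ 0#
    ... | yes _ = sym (⊗-identityˡ a)
    ... | no  _ = sym (⊗-identityʳ a)
    ∏t≡a : Multiplicative.∑ t ≡ a
    ∏t≡a = trans (Multiplicative.∑-single 0# t t≡1) t0≡a
      where
      t≡1 : ∀ x → x ≢ 0# → t x ≡ 1#
      t≡1 x x≢0 with x ≟ 0#
      ... | yes x≡0 = ⊥-elim (x≢0 x≡0)
      ... | no  _   = refl
      t0≡a : t 0# ≡ a
      t0≡a with 0# ≟ 0#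
      ... | yes _   = refl
      ... | no  0≢0 = ⊥-elim (0≢0 refl)
    u≢0 : ∀ x → u x ≢ 0#
    u≢0 x with x ≟ 0#
    ... | yes _   = λ 1≡0 → 0≢1 (sym 1≡0)
    ... | no  x≢0 = x≢0
    u[ax] : ∀ x → u (a ⊗ x) ≡ u x ⊗ s x
    u[ax] x with x ≟ 0# | (a ⊗ x) ≟ 0#
    ... | yes _   | yes _    = sym (⊗-identityˡ 1#)
    ... | yes x≡0 | no  ax≢0 = ⊥-elim (ax≢0 (trans (cong (a ⊗_) x≡0) (⊗-zeroʳ a)))
    ... | no  x≢0 | yes ax≡0 = ⊥-elim (⊗-nonzero a≢0 x≢0 ax≡0)
    ... | no  _   | no  _    = ⊗-comm a x
    a⁻¹ = proj₁ (inverse a a≢0)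
    aa⁻¹x≡x : ∀ x → a ⊗ (a⁻¹ ⊗ x) ≡ x
    aa⁻¹x≡x x = trans (sym (⊗-assoc a a⁻¹ x)) (trans (cong (_⊗ x) (proj₂ (inverse a a≢0))) (⊗-identityˡ x))
    a⁻¹ax≡x : ∀ x → a⁻¹ ⊗ (a ⊗ x) ≡ x
    a⁻¹ax≡x x = trans (solve 3 (λ b c y → b :* (c :* y) := c :* (b :* y)) refl a⁻¹ a x) (aa⁻¹x≡x x)
    ∏u≢0 : Multiplicative.∑ u ≢ 0#
    ∏u≢0 = Multiplicative.∑-closed (_≢ 0#) (λ 1≡0 → 0≢1 (sym 1≡0)) ⊗-nonzero u≢0
    ∏s≡1 : Multiplicative.∑ s ≡ 1#
    ∏s≡1 = ⊗-cancelˡ (Multiplicative.∑ u) ∏u≢0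
      (trans (sym (Multiplicative.∑-distrib-∙ u s)) (trans (sym (Multiplicative.∑-cong u[ax]))
        (trans (Multiplicative.∑-reindex {a ⊗_} {a⁻¹ ⊗_} aa⁻¹x≡x a⁻¹ax≡x u) (sym (⊗-identityʳ _)))))

  -- Horner's scheme, constant coefficient first, with the leading 1 left implicit: the length is
  -- the degree, and the zero polynomial cannot occur.
  evalMonic : ∀ {n} → Vec Carrier n → Carrier → Carrier
  evalMonic []       x = 1#
  evalMonic (c ∷ cs) x = c ⊕ x ⊗ evalMonic cs x

  -- Synthetic division by x - a: the coefficients of the quotient are the values at a of the
  -- successive Horner tails.
  divideRoot : ∀ {n} → Vec Carrier (suc n) → Carrier → Vec Carrier n
  divideRoot (c ∷ [])      a = []
  divideRoot (c ∷ c′ ∷ cs) a = evalMonic (c′ ∷ cs) a ∷ divideRoot (c′ ∷ cs) a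

  -- f(x) − f(a) = (x − a) h(x), with all terms moved so that no subtraction occurs.
  divideRoot-correct : ∀ {n} (cs : Vec Carrier (suc n)) a x →
    evalMonic cs x ⊕ a ⊗ evalMonic (divideRoot cs a) x ≡ x ⊗ evalMonic (divideRoot cs a) x ⊕ evalMonic cs a
  divideRoot-correct (c ∷ []) a x =
    solve 3 (λ c a x → (c :+ x :* con 1) :+ a :* con 1 := x :* con 1 :+ (c :+ a :* con 1)) refl c a x
  divideRoot-correct (c ∷ cs@(_ ∷ _)) a x = begin
    (c ⊕ x ⊗ g x) ⊕ a ⊗ (g a ⊕ x ⊗ h)  ≡⟨ solve 6 (λ c a x gx ga h → (c :+ x :* gx) :+ a :* (ga :+ x :* h) :=
                                             (c :+ a :* ga) :+ x :* (gx :+ a :* h)) refl c a x (g x) (g a) h ⟩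
    (c ⊕ a ⊗ g a) ⊕ x ⊗ (g x ⊕ a ⊗ h)  ≡⟨ cong (λ y → (c ⊕ a ⊗ g a) ⊕ x ⊗ y) (divideRoot-correct cs a x) ⟩
    (c ⊕ a ⊗ g a) ⊕ x ⊗ (x ⊗ h ⊕ g a)  ≡⟨ solve 5 (λ c a x ga h → (c :+ a :* ga) :+ x :* (x :* h :+ ga) :=
                                             x :* (ga :+ x :* h) :+ (c :+ a :* ga)) refl c a x (g a) h ⟩
    x ⊗ (g a ⊕ x ⊗ h) ⊕ (c ⊕ a ⊗ g a)  ∎
    where
    open ≡-Reasoning
    g = evalMonic cs
    h = evalMonic (divideRoot cs a) x

  rootBound : ∀ {n} (cs : Vec Carrier n) → ∑ (λ x → δ (evalMonic cs x) 0#) ≤ + n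
  rootBound [] = ℤₚ.≤-reflexive (trans (∑-cong (λ x → δ-≢ (λ 1≡0 → 0≢1 (sym 1≡0))))
    (trans (∑-const (+ 0)) (ℤₚ.*-zeroʳ (+ size))))
  rootBound {suc n} cs with any? (λ i → evalMonic cs (Inverse.to enum i) ≟ 0#)
  ... | no noRoot = ℤₚ.≤-trans (ℤₚ.≤-reflexive (trans (∑-cong (λ x → δ-≢ (nonzero x)))
          (trans (∑-const (+ 0)) (ℤₚ.*-zeroʳ (+ size))))) (+≤+ z≤n)
    where
    nonzero : ∀ x → evalMonic cs x ≢ 0#
    nonzero x fx≡0 = noRoot (Inverse.from enum x ,
      trans (cong (evalMonic cs) (Inverse.inverseˡ enum refl)) fx≡0)
  ... | yes (i , fa≡0) = ℤₚ.≤-trans (∑-mono pointwise) (ℤₚ.≤-trans (ℤₚ.≤-reflexive (∑-distrib-+ _ _))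
          (ℤₚ.+-mono-≤ (ℤₚ.≤-reflexive (∑-δ a)) (rootBound (divideRoot cs a))))
    where
    a = Inverse.to enum i
    h = evalMonic (divideRoot cs a)
    rootOfQuotient : ∀ x → x ≢ a → evalMonic cs x ≡ 0# → h x ≡ 0#
    rootOfQuotient x x≢a fx≡0 with h x ≟ 0#
    ... | yes hx≡0 = hx≡0
    ... | no  hx≢0 = ⊥-elim (x≢a (⊗-cancelˡ (h x) hx≢0 (trans (⊗-comm (h x) x) (trans (sym ah≡xh) (⊗-comm a (h x))))))
      where
      ah≡xh : a ⊗ h x ≡ x ⊗ h x
      ah≡xh = trans (sym (trans (cong (_⊕ a ⊗ h x) fx≡0) (⊕-identityˡ _)))
        (trans (divideRoot-correct cs a x) (trans (cong (x ⊗ h x ⊕_) fa≡0) (⊕-identityʳ _)))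
    pointwise : ∀ x → δ (evalMonic cs x) 0# ≤ δ x a + δ (h x) 0#
    pointwise x with δ-cases (evalMonic cs x) 0# | δ-cases x a
    ... | inj₂ (_ , e)    | _                = subst (_≤ δ x a + δ (h x) 0#) (sym e) (ℤₚ.+-mono-≤ (δ-≥0 x a) (δ-≥0 (h x) 0#))
    ... | inj₁ (_ , e)    | inj₁ (_ , e′)    = subst₂ (λ s t → s ≤ t + δ (h x) 0#) (sym e) (sym e′)
                                                 (ℤₚ.+-monoʳ-≤ (+ 1) (δ-≥0 (h x) 0#))
    ... | inj₁ (fx≡0 , e) | inj₂ (x≢a , e′)  = ℤₚ.≤-reflexive (trans e (sym (cong₂ _+_ e′ (δ-≡ (rootOfQuotient x x≢a fx≡0)))))

  MonicOfDegree : ℕ → (Carrier → Carrier) → Set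
  MonicOfDegree n f = ∃[ cs ] (∀ x → f x ≡ evalMonic {n} cs x)

  monic-pow : ∀ n → MonicOfDegree n (λ x → pow x n)
  monic-pow zero    = [] , λ x → refl
  monic-pow (suc n) with cs , e ← monic-pow n = 0# ∷ cs , λ x → trans (cong (x ⊗_) (e x)) (sym (⊕-identityˡ _))

  monic-+-lower : ∀ {n f} → MonicOfDegree n f → ∀ a i → i ℕ.< n → MonicOfDegree n (λ x → f x ⊕ a ⊗ pow x i)
  monic-+-lower (c ∷ cs , e) a zero i<n = (c ⊕ a) ∷ cs , λ x → trans (cong (_⊕ a ⊗ 1#) (e x))
    (solve 4 (λ c a x g → (c :+ x :* g) :+ a :* con 1 := (c :+ a) :+ x :* g) refl c a x (evalMonic cs x))
  monic-+-lower (c ∷ cs , e) a (suc i) (s≤s i<n) with ds , e′ ← monic-+-lower (cs , λ x → refl) a i i<n =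
    c ∷ ds , λ x → trans (cong (_⊕ a ⊗ (x ⊗ pow x i)) (e x))
      (trans (solve 5 (λ c a x g y → (c :+ x :* g) :+ a :* (x :* y) := c :+ x :* (g :+ a :* y)) refl c a x (evalMonic cs x) (pow x i))
        (cong (λ y → c ⊕ x ⊗ y) (e′ x)))

  monic-rootBound : ∀ {n f} → MonicOfDegree n f → ∑ (λ x → δ (f x) 0#) ≤ + n
  monic-rootBound (cs , e) = ℤₚ.≤-trans (ℤₚ.≤-reflexive (∑-cong (λ x → cong (λ y → δ y 0#) (e x)))) (rootBound cs)

  module Frobenius {p} (pp : Prime p) (p·1≡0 : p · 1# ≡ 0#) where
    open CommutativeMonoidSum +-commutativeMonoid using (sum; sum-init-last; sum-cong-≋; sum-replicate-zero)

    p∣n⇒n·x≡0 : ∀ {n} → p ∣ n → ∀ x → n · x ≡ 0#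
    p∣n⇒n·x≡0 (divides j refl) x = trans (sym (×-assocˡ x j p)) (trans (cong (j ·_) p·x≡0)
      (trans (cong (j ·_) (sym (⊗-zeroˡ 0#))) (trans (sym (×-assoc-* j 0# 0#)) (⊗-zeroʳ _))))
      where
      p·x≡0 : p · x ≡ 0#
      p·x≡0 = trans (cong (p ·_) (sym (⊗-identityˡ x))) (trans (sym (×-assoc-* p 1# x))
        (trans (cong (_⊗ x) p·1≡0) (⊗-zeroˡ x)))

    pow-p-additive : ∀ x y → pow (x ⊕ y) p ≡ pow x p ⊕ pow y p
    pow-p-additive x y = byDegree p refl
      where
      byDegree : ∀ n → p ≡ n → pow (x ⊕ y) n ≡ pow x n ⊕ pow y n
      byDegree zero        eq = ⊥-elim (ℕ.≢-nonZero⁻¹ p {{prime⇒nonZero pp}} eq)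
      byDegree n@(suc n-1) eq = begin
        pow (x ⊕ y) n                             ≡⟨ pow≡^ (x ⊕ y) n ⟩
        (x ⊕ y) ^ᴷ n                              ≡⟨ Binomial.theorem commutativeSemiring n x y ⟩
        term zero ⊕ sum (term ∘ suc)              ≡⟨ cong (term zero ⊕_) (sum-init-last (term ∘ suc)) ⟩
        term zero ⊕ (sum {n-1} (λ k → term (suc (inject₁ k))) ⊕ term (fromℕ n))
          ≡⟨ cong₂ _⊕_ first (cong₂ _⊕_ (trans (sum-cong-≋ middle) (sum-replicate-zero n-1)) lastTerm) ⟩
        pow y n ⊕ (0# ⊕ pow x n)                  ≡⟨ cong (pow y n ⊕_) (⊕-identityˡ _) ⟩
        pow y n ⊕ pow x n                         ≡⟨ ⊕-comm _ _ ⟩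
        pow x n ⊕ pow y n                         ∎
        where
        open ≡-Reasoning
        term : Fin (suc n) → Carrier
        term = Binomial.binomialTerm commutativeSemiring x y n
        first : term zero ≡ pow y n
        first = trans (⊕-identityʳ _) (trans (⊗-identityˡ _) (sym (pow≡^ y n)))
        lastTerm : term (fromℕ n) ≡ pow x n
        lastTerm rewrite toℕ-fromℕ n-1 | nCn≡1 n | ℕₚ.n∸n≡0 n-1 =
          trans (⊕-identityʳ _) (trans (⊗-identityʳ _) (sym (pow≡^ x n)))
        middle : ∀ k → term (suc (inject₁ k)) ≡ 0#
        middle k = p∣n⇒n·x≡0 (subst (λ r → r ∣ n C suc (toℕ (inject₁ k))) (sym eq)
          (prime∣pCk (subst Prime eq pp) (suc (toℕ (inject₁ k))) (s≤s z≤n)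
            (s≤s (subst (ℕ._< n-1) (sym (toℕ-inject₁ k)) (toℕ<n k))))) _

    pow-p^-additive : ∀ n x y → pow (x ⊕ y) (p ^ n) ≡ pow x (p ^ n) ⊕ pow y (p ^ n)
    pow-p^-additive zero    x y = trans (⊗-identityʳ _) (sym (cong₂ _⊕_ (⊗-identityʳ x) (⊗-identityʳ y)))
    pow-p^-additive (suc n) x y = trans (pow-suc-comm (x ⊕ y) p n) (trans (cong (λ z → pow z p) (pow-p^-additive n x y))
      (trans (pow-p-additive _ _) (sym (cong₂ _⊕_ (pow-suc-comm x p n) (pow-suc-comm y p n)))))

-- The trace

module TraceTheory (K : FiniteField) {p : ℕ} (pp : Prime p) {e : ℕ} (e≥1 : e ≥ 1) (n : ℕ)
                   (size≡q^m : FiniteField.size K ≡ (p ^ e) ^ suc n) where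
  open FieldTheory K public

  -- With m = `suc n`, `Q` is q^(m-1), which will be the size of each hyperplane and of each fibre
  -- of the trace over F_q.
  q Q : ℕ
  q = p ^ e
  Q = q ^ n

  open Frobenius pp (size≡⇒p·1≡0 p e (suc n) size≡q^m)

  1<q : 1 ℕ.< q
  1<q = ℕₚ.<-≤-trans (ℕ.nonTrivial⇒n>1 p {{prime⇒nonTrivial pp}})
    (subst (ℕ._≤ q) (ℕₚ.^-identityʳ p) (ℕₚ.^-monoʳ-≤ p {{prime⇒nonZero pp}} e≥1))

  instance
    q≢0 : NonZero q
    q≢0 = ℕ.>-nonZero (ℕₚ.<-trans (s≤s z≤n) 1<q)

  Q>0 : 0 ℕ.< Q
  Q>0 = ℕₚ.m^n>0 q n

  size≡qQ : + size ≡ + q * + Q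
  size≡qQ = trans (cong +_ size≡q^m) (ℤₚ.pos-* q Q)

  pow-q-additive : ∀ x y → pow (x ⊕ y) q ≡ pow x q ⊕ pow y q
  pow-q-additive = pow-p^-additive e

  pow-q^-additive : ∀ i x y → pow (x ⊕ y) (q ^ i) ≡ pow x (q ^ i) ⊕ pow y (q ^ i)
  pow-q^-additive i x y rewrite ℕₚ.^-*-assoc p e i = pow-p^-additive (e ℕ.* i) x y

  Fq-0 : InFq q 0#
  Fq-0 = pow-0# q

  Fq-1 : InFq q 1#
  Fq-1 = pow-1# q

  Fq-⊗ : ∀ {x y} → InFq q x → InFq q y → InFq q (x ⊗ y)
  Fq-⊗ {x} {y} x∈ y∈ = trans (pow-distrib-⊗ x y q) (cong₂ _⊗_ x∈ y∈)

  Fq-⊖ : ∀ {x} → InFq q x → InFq q (⊖ x)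
  Fq-⊖ {x} x∈ = ⊖-uniqueˡ _ x (trans (cong (pow (⊖ x) q ⊕_) (sym x∈))
    (trans (sym (pow-q-additive (⊖ x) x)) (trans (cong (λ y → pow y q) (⊖-inverseˡ x)) Fq-0)))

  Fq-inverse : ∀ {x} → InFq q x → x ≢ 0# → ∃[ y ] (InFq q y × x ⊗ y ≡ 1#)
  Fq-inverse {x} x∈ x≢0 with y , xy≡1 ← inverse x x≢0 = y ,
    ⊗-cancelˡ x x≢0 (trans (cong (_⊗ pow y q) (sym x∈)) (trans (sym (pow-distrib-⊗ x y q))
      (trans (cong (λ z → pow z q) xy≡1) (trans Fq-1 (sym xy≡1))))) , xy≡1

  Fq-pow-q^ : ∀ {x} → InFq q x → ∀ i → pow x (q ^ i) ≡ x
  Fq-pow-q^ {x} x∈ zero    = ⊗-identityʳ x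
  Fq-pow-q^ {x} x∈ (suc i) = trans (pow-suc-comm x q i) (trans (cong (λ y → pow y q) (Fq-pow-q^ x∈ i)) x∈)

  Tr-suc : ∀ i x → Tr q (suc i) x ≡ Tr q i x ⊕ pow x (q ^ i)
  Tr-suc i x = trans (asSum (suc i)) (trans (sum-last (λ j → pow x (q ^ j)) i)
    (cong (_⊕ pow x (q ^ i)) (sym (asSum i))))
    where
    asSum : ∀ i → Tr q i x ≡ ∑F (applyUpTo (λ j → pow x (q ^ j)) i)
    asSum i = cong ∑F (map-upTo (λ j → pow x (q ^ j)) i)
    sum-last : ∀ f i → ∑F (applyUpTo f (suc i)) ≡ ∑F (applyUpTo f i) ⊕ f i
    sum-last f zero    = trans (⊕-identityʳ _) (sym (⊕-identityˡ _))
    sum-last f (suc i) = trans (cong (f 0 ⊕_) (sum-last (f ∘ suc) i)) (sym (⊕-assoc _ _ _))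

  private
    Tr-additive : ∀ i x y → Tr q i (x ⊕ y) ≡ Tr q i x ⊕ Tr q i y
    Tr-additive zero    x y = sym (⊕-identityˡ 0#)
    Tr-additive (suc i) x y = trans (Tr-suc i (x ⊕ y)) (trans (cong₂ _⊕_ (Tr-additive i x y) (pow-q^-additive i x y))
      (trans (solve 4 (λ a b c d → (a :+ b) :+ (c :+ d) := (a :+ c) :+ (b :+ d)) refl _ _ _ _)
        (sym (cong₂ _⊕_ (Tr-suc i x) (Tr-suc i y)))))

    Tr-linear : ∀ i {l} → InFq q l → ∀ x → Tr q i (l ⊗ x) ≡ l ⊗ Tr q i x
    Tr-linear zero    {l} l∈ x = sym (⊗-zeroʳ l)
    Tr-linear (suc i) {l} l∈ x = trans (Tr-suc i (l ⊗ x)) (trans (cong₂ _⊕_ (Tr-linear i l∈ x)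
      (trans (pow-distrib-⊗ l x (q ^ i)) (cong (_⊗ pow x (q ^ i)) (Fq-pow-q^ l∈ i))))
      (trans (sym (⊗-distribˡ l _ _)) (cong (l ⊗_) (sym (Tr-suc i x)))))

    -- Both sides are x + x^q + ... + x^(q^i). At i = m the last power is x by `fermat`, and
    -- cancelling x shows that the trace lies in F_q.
    Tr-telescope : ∀ i x → pow (Tr q i x) q ⊕ x ≡ Tr q i x ⊕ pow x (q ^ i)
    Tr-telescope zero    x = cong₂ _⊕_ (pow-0# q) (sym (⊗-identityʳ x))
    Tr-telescope (suc i) x = begin
      pow (Tr q (suc i) x) q ⊕ x                  ≡⟨ cong (λ y → pow y q ⊕ x) (Tr-suc i x) ⟩
      pow (Tr q i x ⊕ pow x (q ^ i)) q ⊕ x        ≡⟨ cong (_⊕ x) (pow-q-additive _ _) ⟩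
      (pow (Tr q i x) q ⊕ pow (pow x (q ^ i)) q) ⊕ x  ≡⟨ solve 3 (λ a b c → (a :+ b) :+ c := (a :+ c) :+ b) refl _ _ _ ⟩
      (pow (Tr q i x) q ⊕ x) ⊕ pow (pow x (q ^ i)) q  ≡⟨ cong₂ _⊕_ (Tr-telescope i x) (sym (pow-suc-comm x q i)) ⟩
      (Tr q i x ⊕ pow x (q ^ i)) ⊕ pow x (q ^ suc i)  ≡⟨ cong (_⊕ pow x (q ^ suc i)) (sym (Tr-suc i x)) ⟩
      Tr q (suc i) x ⊕ pow x (q ^ suc i)          ∎
      where open ≡-Reasoning

    monic-+-Tr : ∀ {N f} i → (∀ j → j ℕ.< i → q ^ j ℕ.< N) → MonicOfDegree N f → MonicOfDegree N (λ x → f x ⊕ Tr q i x)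
    monic-+-Tr zero    <N (cs , f≡) = cs , λ x → trans (⊕-identityʳ _) (f≡ x)
    monic-+-Tr (suc i) <N f-monic
      with cs , g≡ ← monic-+-lower (monic-+-Tr i (λ j j<i → <N j (ℕₚ.m<n⇒m<1+n j<i)) f-monic) 1# (q ^ i) (<N i (ℕₚ.n<1+n i)) =
      cs , λ x → trans (trans (cong (_ ⊕_) (trans (Tr-suc i x) (cong (Tr q i x ⊕_) (sym (⊗-identityˡ _))))) (sym (⊕-assoc _ _ _))) (g≡ x)

  opaque
    T : Carrier → Carrier
    T = Tr q (suc n)

    T≡Tr : ∀ x → T x ≡ Tr q (suc n) x
    T≡Tr x = refl

    T-⊕ : ∀ x y → T (x ⊕ y) ≡ T x ⊕ T y
    T-⊕ = Tr-additive (suc n)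

    T-⊗ : ∀ {l} → InFq q l → ∀ x → T (l ⊗ x) ≡ l ⊗ T x
    T-⊗ = Tr-linear (suc n)

    T∈Fq : ∀ x → InFq q (T x)
    T∈Fq x = ⊕-cancelʳ x _ _ (trans (Tr-telescope (suc n) x)
      (cong (T x ⊕_) (trans (cong (pow x) (sym size≡q^m)) (fermat x))))

    -- The last summand x^(q^n) of the trace is the leading term; the remaining exponents q^j with j
    -- < n are smaller because q > 1.
    T-monic : ∀ c → MonicOfDegree Q (λ x → T x ⊕ c)
    T-monic c with cs , f≡ ← monic-+-lower (monic-+-Tr n (λ j → ℕₚ.^-monoʳ-< q 1<q) (monic-pow Q)) c 0 Q>0 =
      cs , λ x → trans (cong₂ _⊕_ (trans (Tr-suc n x) (⊕-comm _ _)) (sym (⊗-identityʳ c))) (f≡ x)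

  T-0 : T 0# ≡ 0#
  T-0 = trans (cong T (sym (⊗-zeroˡ 0#))) (trans (T-⊗ Fq-0 0#) (⊗-zeroˡ _))

  -- The indicator of F_q. Sums over F_q are written as sums over K weighted by it.
  φ : Carrier → ℤ
  φ x = δ (pow x q) x

  fibreSize : Carrier → ℤ
  fibreSize t = ∑ (λ x → δ (T x) t)

  ⊕⊖≡0⇒≡ : ∀ {x y} → x ⊕ ⊖ y ≡ 0# → x ≡ y
  ⊕⊖≡0⇒≡ {x} {y} e = trans (sym (⊖⊕-assoc x y)) (trans (cong (_⊕ y) e) (⊕-identityˡ y))

  ≡⇒⊕⊖≡0 : ∀ {x y} → x ≡ y → x ⊕ ⊖ y ≡ 0#
  ≡⇒⊕⊖≡0 {x} refl = ⊖-inverseʳ x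

  fibreSize≤Q : ∀ t → fibreSize t ≤ + Q
  fibreSize≤Q t = subst (_≤ + Q) (∑-cong (λ x → δ-cong ⊕⊖≡0⇒≡ ≡⇒⊕⊖≡0)) (monic-rootBound (T-monic (⊖ t)))

  ∑φ≤q : ∑ φ ≤ + q
  ∑φ≤q = subst (_≤ + q) (∑-cong (λ x → δ-cong (λ r → ⊕⊖≡0⇒≡ (trans (sym (simplify x)) r)) (λ r → trans (simplify x) (≡⇒⊕⊖≡0 r))))
    (monic-rootBound (monic-+-lower (monic-pow q) (⊖ 1#) 1 1<q))
    where
    simplify : ∀ x → pow x q ⊕ ⊖ 1# ⊗ pow x 1 ≡ pow x q ⊕ ⊖ x
    simplify x = cong (pow x q ⊕_) (trans (sym (⊖-distribˡ-⊗ 1# _)) (cong ⊖_ (trans (⊗-identityˡ _) (⊗-identityʳ x))))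

  ∑φ*fibreSize : ∑ (λ t → φ t * fibreSize t) ≡ + q * + Q
  ∑φ*fibreSize = begin
    ∑ (λ t → φ t * fibreSize t)              ≡⟨ ∑-cong (λ t → sym (∑-*ˡ (φ t) (λ x → δ (T x) t))) ⟩
    ∑ (λ t → ∑ (λ x → φ t * δ (T x) t))      ≡⟨ ∑-comm (λ t x → φ t * δ (T x) t) ⟩
    ∑ (λ x → ∑ (λ t → φ t * δ (T x) t))      ≡⟨ ∑-cong (λ x → ∑-cong (λ t → trans (ℤₚ.*-comm (φ t) _) (cong (_* φ t) (δ-cong sym sym)))) ⟩
    ∑ (λ x → ∑ (λ t → δ t (T x) * φ t))      ≡⟨ ∑-cong (λ x → trans (∑-δˡ (T x) φ) (δ-≡ (T∈Fq x))) ⟩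
    ∑ (λ x → + 1)                            ≡⟨ ∑-const (+ 1) ⟩
    + size * + 1                             ≡⟨ ℤₚ.*-identityʳ (+ size) ⟩
    + size                                   ≡⟨ size≡qQ ⟩
    + q * + Q                                ∎
    where open ≡-Reasoning

  φ*fibreSize≤ : ∀ t → φ t * fibreSize t ≤ + Q * φ t
  φ*fibreSize≤ t with δ-cases (pow t q) t
  ... | inj₁ (_ , e) = subst (λ d → d * fibreSize t ≤ + Q * d) (sym e)
          (subst₂ _≤_ (sym (ℤₚ.*-identityˡ _)) (sym (ℤₚ.*-identityʳ (+ Q))) (fibreSize≤Q t))
  ... | inj₂ (_ , e) = subst (λ d → d * fibreSize t ≤ + Q * d) (sym e)
          (ℤₚ.≤-reflexive (trans (ℤₚ.*-zeroˡ (fibreSize t)) (sym (ℤₚ.*-zeroʳ (+ Q)))))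

  -- The fibres over F_q cover all qQ elements and have at most Q elements each, so F_q has at least
  -- q elements; the root bound gives the converse.
  |Fq|≡q : ∑ φ ≡ + q
  |Fq|≡q = ℤₚ.≤-antisym ∑φ≤q (ℤₚ.*-cancelˡ-≤-pos (+ q) (∑ φ) (+ Q) {{ℤ.positive (ℤ.+<+ Q>0)}}
    (subst₂ _≤_ (trans ∑φ*fibreSize (ℤₚ.*-comm (+ q) (+ Q))) (∑-*ˡ (+ Q) φ) (∑-mono φ*fibreSize≤)))

  -- Equality holds in the sum of the bounds `fibreSize≤Q` over F_q. The defects are nonnegative
  -- with sum zero, so each of them vanishes.
  fibreSize≡Q : ∀ {t} → InFq q t → fibreSize t ≡ + Q
  fibreSize≡Q {t} t∈ = ℤₚ.≤-antisym (fibreSize≤Q t) (ℤₚ.i-j≤0⇒i≤j (ℤₚ.≤-trans defect-t≤∑ (ℤₚ.≤-reflexive ∑defect≡0)))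
    where
    defect : Carrier → ℤ
    defect s = + Q * φ s - φ s * fibreSize s
    ∑defect≡0 : ∑ defect ≡ + 0
    ∑defect≡0 = trans (∑-distrib-- (λ s → + Q * φ s) (λ s → φ s * fibreSize s))
      (ℤₚ.i≡j⇒i-j≡0 (trans (∑-*ˡ (+ Q) φ) (trans (cong (λ s → + Q * s) |Fq|≡q) (trans (ℤₚ.*-comm (+ Q) (+ q)) (sym ∑φ*fibreSize)))))
    defect-t : defect t ≡ + Q - fibreSize t
    defect-t = trans (cong (λ d → + Q * d - d * fibreSize t) (δ-≡ t∈))
      (cong₂ _-_ (ℤₚ.*-identityʳ (+ Q)) (ℤₚ.*-identityˡ (fibreSize t)))
    defect≥0 : ∀ s → + 0 ≤ defect s
    defect≥0 s = ℤₚ.i≤j⇒0≤j-i (φ*fibreSize≤ s)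
    pointwise : ∀ s → δ s t * defect s ≤ defect s
    pointwise s with δ-cases s t
    ... | inj₁ (_ , e′) = ℤₚ.≤-reflexive (trans (cong (λ d → d * defect s) e′) (ℤₚ.*-identityˡ (defect s)))
    ... | inj₂ (_ , e′) = subst (_≤ defect s) (sym (trans (cong (λ d → d * defect s) e′) (ℤₚ.*-zeroˡ (defect s)))) (defect≥0 s)
    defect-t≤∑ : + Q - fibreSize t ≤ ∑ defect
    defect-t≤∑ = subst (_≤ ∑ defect) (trans (∑-δˡ t defect) defect-t) (∑-mono pointwise)

  ∑-scale : ∀ {v} → v ≢ 0# → ∀ (f : Carrier → ℤ) → ∑ (λ x → f (v ⊗ x)) ≡ ∑ f
  ∑-scale {v} v≢0 f with w , vw≡1 ← inverse v v≢0 =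
    ∑-reindex {v ⊗_} {w ⊗_} (λ x → trans (sym (⊗-assoc v w x)) (trans (cong (_⊗ x) vw≡1) (⊗-identityˡ x)))
      (λ x → trans (sym (⊗-assoc w v x)) (trans (cong (_⊗ x) (trans (⊗-comm w v) vw≡1)) (⊗-identityˡ x))) f

  hyperplaneSize : ∀ {v} → v ≢ 0# → ∀ {t} → InFq q t → ∑ (λ x → δ (T (v ⊗ x)) t) ≡ + Q
  hyperplaneSize v≢0 {t} t∈ = trans (∑-scale v≢0 (λ x → δ (T x) t)) (fibreSize≡Q t∈)

-- Restricted eigenvalues

-- Subtracting the equations of r and s gives r + s = a. Then x - s = x + r - a, and (x - r)(x + r -
-- a) is the difference of the equations of x and r.
quadratic-roots : ∀ a b r s x → r ≢ s → r * r ≡ a * r + b → s * s ≡ a * s + b → x * x ≡ a * x + b → x ≡ r ⊎ x ≡ s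
quadratic-roots a b r s x r≢s r-root s-root x-root =
  [ (λ e → inj₁ (ℤₚ.i-j≡0⇒i≡j x r e)) , (λ e → inj₂ (ℤₚ.i-j≡0⇒i≡j x s e)) ]′ (ℤₚ.i*j≡0⇒i≡0∨j≡0 (x - r) product≡0)
  where
  difference : ∀ x y a → x * x - y * y - a * (x - y) ≡ (x - y) * (x + y - a)
  difference = solve-∀
  cancel : ∀ a x y b → (a * x + b) - (a * y + b) - a * (x - y) ≡ + 0
  cancel = solve-∀
  roots : ∀ x y → x * x ≡ a * x + b → y * y ≡ a * y + b → (x - y) * (x + y - a) ≡ + 0
  roots x y ex ey = trans (sym (difference x y a)) (trans (cong₂ (λ u v → u - v - a * (x - y)) ex ey) (cancel a x y b))
  sum≡a : r + s - a ≡ + 0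
  sum≡a = [ (λ e → ⊥-elim (r≢s (ℤₚ.i-j≡0⇒i≡j r s e))) , id ]′ (ℤₚ.i*j≡0⇒i≡0∨j≡0 (r - s) (roots r s r-root s-root))
  shift : ∀ x r s a → x - s ≡ (x + r - a) - (r + s - a)
  shift = solve-∀
  x-s≡x+r-a : x - s ≡ x + r - a
  x-s≡x+r-a = trans (shift x r s a) (trans (cong (λ u → (x + r - a) - u) sum≡a) (ℤₚ.+-identityʳ (x + r - a)))
  product≡0 : (x - r) * (x - s) ≡ + 0
  product≡0 = trans (cong (λ u → (x - r) * u) x-s≡x+r-a) (roots x r x-root r-root)

module StronglyRegular (K : FiniteField) (D : FF.Subset K) {v k l μ : ℕ} (pds : FF.IsPDS K D v k l μ) where
  open FF K using (adj; ind; IsSRG; count; RestrictedEigenvalue)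
  open FieldTheory K
  private
    D0≡false = proj₁ (proj₁ pds)
    D-symmetric = proj₂ (proj₁ pds)
  open IsSRG (proj₂ pds)

  d : Carrier → ℤ
  d x = ind (D x)

  D-cases : ∀ x → (D x ≡ true × d x ≡ + 1) ⊎ (D x ≡ false × d x ≡ + 0)
  D-cases x with D x
  ... | true  = inj₁ (refl , refl)
  ... | false = inj₂ (refl , refl)

  ⊖-⊕⊖ : ∀ x y → ⊖ (x ⊕ ⊖ y) ≡ y ⊕ ⊖ x
  ⊖-⊕⊖ x y = trans (sym (⊖-uniqueˡ (y ⊕ ⊖ x) (x ⊕ ⊖ y) (trans (sym (⊕-assoc _ x (⊖ y)))
    (trans (cong (_⊕ ⊖ y) (⊖⊕-assoc y x)) (⊖-inverseʳ y))))) refl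

  x⊖[x⊖y] : ∀ x y → x ⊕ ⊖ (x ⊕ ⊖ y) ≡ y
  x⊖[x⊖y] x y = trans (cong (x ⊕_) (⊖-⊕⊖ x y)) (trans (⊕-comm x _) (⊖⊕-assoc y x))

  ∑-reflect : ∀ a (f : Carrier → ℤ) → ∑ (λ y → f (a ⊕ ⊖ y)) ≡ ∑ f
  ∑-reflect a f = ∑-reindex {λ y → a ⊕ ⊖ y} {λ y → a ⊕ ⊖ y} (x⊖[x⊖y] a) (x⊖[x⊖y] a) f

  A : Carrier → Carrier → ℤ
  A x y = ind (adj D x y)

  ∑d≡k : ∑ d ≡ + k
  ∑d≡k = trans (sym (∑-reflect 0# d)) (trans (sym (count≡∑ (adj D 0#))) (cong +_ (regular 0#)))

  A-sym : ∀ x y → A x y ≡ A y x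
  A-sym x y = cong ind (trans (sym (D-symmetric _)) (cong D (⊖-⊕⊖ x y)))

  ind-∧ : ∀ a b → ind (a ∧ b) ≡ ind a * ind b
  ind-∧ true  true  = refl
  ind-∧ true  false = refl
  ind-∧ false true  = refl
  ind-∧ false false = refl

  -- The entries of A², with the diagonal, adjacent and nonadjacent cases in one linear formula that
  -- can be summed against an eigenvector.
  commonNeighbours : ∀ x z → ∑ (λ y → A x y * A z y) ≡ (+ k - + μ) * δ z x + (+ l - + μ) * A x z + + μ
  commonNeighbours x z = trans (sym (trans (count≡∑ _) (∑-cong (λ y → ind-∧ (adj D x y) (adj D z y))))) (byCases (δ-cases z x))
    where
    ∧-idem : ∀ b → ind (b ∧ b) ≡ ind b
    ∧-idem true  = refl
    ∧-idem false = refl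
    equal : ∀ a b c → a ≡ (a - c) * + 1 + (b - c) * + 0 + c
    equal = solve-∀
    adjacent : ∀ a b c → b ≡ (a - c) * + 0 + (b - c) * + 1 + c
    adjacent = solve-∀
    nonadjacent : ∀ a b c → c ≡ (a - c) * + 0 + (b - c) * + 0 + c
    nonadjacent = solve-∀
    byCases : _ → + count (λ y → adj D x y ∧ adj D z y) ≡ (+ k - + μ) * δ z x + (+ l - + μ) * A x z + + μ
    byCases (inj₁ (refl , e)) rewrite e = trans (count≡∑ _)
      (trans (∑-cong (λ y → ∧-idem (adj D x y))) (trans (sym (count≡∑ (adj D x))) (trans (cong +_ (regular x))
      (trans (equal (+ k) (+ l) (+ μ)) (cong (λ a → (+ k - + μ) * + 1 + (+ l - + μ) * a + + μ)
        (sym (cong ind (trans (cong D (⊖-inverseʳ x)) D0≡false))))))))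
    byCases (inj₂ (z≢x , e)) rewrite e with adj D x z in Axz
    ... | true  = trans (cong +_ (adjacentCommon x z (z≢x ∘ sym) Axz)) (adjacent (+ k) (+ l) (+ μ))
    ... | false = trans (cong +_ (nonadjacentCommon x z (z≢x ∘ sym) Axz)) (nonadjacent (+ k) (+ l) (+ μ))

  -- A² = (k − μ) I + (λ − μ) A + μ J, and J annihilates an eigenvector of sum zero.
  restrictedEigenvalue-quadratic : ∀ θ → RestrictedEigenvalue D θ → θ * θ ≡ (+ l - + μ) * θ + (+ k - + μ)
  restrictedEigenvalue-quadratic θ (f , (x , fx≢0) , ∑f≡0 , Af≡θf) =
    ℤₚ.*-cancelʳ-≡ (θ * θ) _ (f x) {{ℤ.≢-nonZero fx≢0}} (trans (sym AAf-eigen) AAf-srg)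
    where
    open ≡-Reasoning
    Af : ∀ x → ∑ (λ y → A x y * f y) ≡ θ * f x
    Af x = trans (sym (∑ℤ≡∑ _)) (Af≡θf x)
    pull : ∀ a b c → a * (b * c) ≡ b * (a * c)
    pull = solve-∀
    AAf : ℤ
    AAf = ∑ (λ y → A x y * ∑ (λ z → A y z * f z))
    AAf-eigen : AAf ≡ θ * θ * f x
    AAf-eigen = begin
      AAf                           ≡⟨ ∑-cong (λ y → trans (cong (λ s → A x y * s) (Af y)) (pull (A x y) θ (f y))) ⟩
      ∑ (λ y → θ * (A x y * f y))   ≡⟨ ∑-*ˡ θ (λ y → A x y * f y) ⟩
      θ * ∑ (λ y → A x y * f y)     ≡⟨ cong (λ s → θ * s) (Af x) ⟩
      θ * (θ * f x)                 ≡⟨ sym (ℤₚ.*-assoc θ θ (f x)) ⟩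
      θ * θ * f x                   ∎
    rotate : ∀ a b c → a * (b * c) ≡ c * (a * b)
    rotate = solve-∀
    expand : ∀ c a b i j m → c * (a * i + b * j + m) ≡ a * (i * c) + b * (j * c) + m * c
    expand = solve-∀
    collect : ∀ a b t g m → a * g + b * (t * g) + m * + 0 ≡ (b * t + a) * g
    collect = solve-∀
    AAf-srg : AAf ≡ ((+ l - + μ) * θ + (+ k - + μ)) * f x
    AAf-srg = begin
      AAf ≡⟨ ∑-cong (λ y → sym (∑-*ˡ (A x y) (λ z → A y z * f z))) ⟩
      ∑ (λ y → ∑ (λ z → A x y * (A y z * f z))) ≡⟨ ∑-comm (λ y z → A x y * (A y z * f z)) ⟩
      ∑ (λ z → ∑ (λ y → A x y * (A y z * f z))) ≡⟨ ∑-cong (λ z → trans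
        (∑-cong (λ y → trans (cong (λ s → A x y * (s * f z)) (A-sym y z)) (rotate (A x y) (A z y) (f z))))
        (∑-*ˡ (f z) (λ y → A x y * A z y))) ⟩
      ∑ (λ z → f z * ∑ (λ y → A x y * A z y)) ≡⟨ ∑-cong (λ z → trans (cong (λ s → f z * s) (commonNeighbours x z))
        (expand (f z) (+ k - + μ) (+ l - + μ) (δ z x) (A x z) (+ μ))) ⟩
      ∑ (λ z → (+ k - + μ) * (δ z x * f z) + (+ l - + μ) * (A x z * f z) + + μ * f z)
        ≡⟨ trans (∑-distrib-+ (λ z → (+ k - + μ) * (δ z x * f z) + (+ l - + μ) * (A x z * f z)) (λ z → + μ * f z))
             (cong₂ _+_ (trans (∑-distrib-+ (λ z → (+ k - + μ) * (δ z x * f z)) (λ z → (+ l - + μ) * (A x z * f z)))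
               (cong₂ _+_ (trans (∑-*ˡ (+ k - + μ) _) (cong (λ s → (+ k - + μ) * s) (∑-δˡ x f)))
                          (trans (∑-*ˡ (+ l - + μ) _) (cong (λ s → (+ l - + μ) * s) (Af x)))))
               (trans (∑-*ˡ (+ μ) f) (cong (λ s → + μ * s) (trans (sym (∑ℤ≡∑ f)) ∑f≡0)))) ⟩
      (+ k - + μ) * f x + (+ l - + μ) * (θ * f x) + + μ * + 0 ≡⟨ collect (+ k - + μ) (+ l - + μ) θ (f x) (+ μ) ⟩
      ((+ l - + μ) * θ + (+ k - + μ)) * f x ∎

  restrictedEigenvalue-two : ∀ {θ₁ θ₂ χ} → θ₁ ≢ θ₂ → RestrictedEigenvalue D θ₁ → RestrictedEigenvalue D θ₂ →
                             RestrictedEigenvalue D χ → χ ≡ θ₁ ⊎ χ ≡ θ₂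
  restrictedEigenvalue-two {θ₁} {θ₂} {χ} θ₁≢θ₂ r₁ r₂ r = quadratic-roots (+ l - + μ) (+ k - + μ) θ₁ θ₂ χ θ₁≢θ₂
    (restrictedEigenvalue-quadratic θ₁ r₁) (restrictedEigenvalue-quadratic θ₂ r₂) (restrictedEigenvalue-quadratic χ r)

-- Intersections with hyperplanes

module Counting (K : FiniteField) {p : ℕ} (pp : Prime p) {e : ℕ} (e≥1 : e ≥ 1) (n : ℕ)
                (size≡q^m : FiniteField.size K ≡ (p ^ e) ^ suc n)
                (D : FF.Subset K) {k l μ : ℕ} (pds : FF.IsPDS K D ((p ^ e) ^ suc n) k l μ)
                (D-invariant : FF.FqInvariant K (p ^ e) D) where
  open FF K using (RestrictedEigenvalue; ind)
  open TraceTheory K pp e≥1 n size≡q^m public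
  open StronglyRegular K D pds public

  q-1 : ℤ
  q-1 = + q - + 1

  D0≡false : D 0# ≡ false
  D0≡false = proj₁ (proj₁ pds)

  φ-cong : ∀ t {x y : ℤ} → (InFq q t → x ≡ y) → φ t * x ≡ φ t * y
  φ-cong t {x} {y} x≡y with δ-cases (pow t q) t
  ... | inj₁ (t∈ , _) = cong (λ z → φ t * z) (x≡y t∈)
  ... | inj₂ (_ , e)  = trans (cong (λ z → z * x) e) (trans (ℤₚ.*-zeroˡ x) (sym (trans (cong (λ z → z * y) e) (ℤₚ.*-zeroˡ y))))

  ∑φ* : ∀ c → ∑ (λ t → φ t * c) ≡ + q * c
  ∑φ* c = trans (∑-cong (λ t → ℤₚ.*-comm (φ t) c)) (trans (∑-*ˡ c φ) (trans (cong (λ s → c * s) |Fq|≡q) (ℤₚ.*-comm c (+ q))))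

  Span : Carrier → Carrier → Set
  Span v w = ∃[ l ] (InFq q l × w ≡ l ⊗ v)

  span? : ∀ {v} → v ≢ 0# → ∀ w → Dec (Span v w)
  span? {v} v≢0 w with inverse v v≢0
  ... | v⁻¹ , vv⁻¹≡1 with pow (w ⊗ v⁻¹) q ≟ w ⊗ v⁻¹
  ... | yes l∈ = yes (w ⊗ v⁻¹ , l∈ , sym (trans (solve 3 (λ a b c → a :* b :* c := a :* (c :* b)) refl w v⁻¹ v)
                   (trans (cong (w ⊗_) vv⁻¹≡1) (⊗-identityʳ w))))
  ... | no  l∉ = no λ { (l , l∈ , refl) → l∉ (subst (InFq q) (sym (trans (⊗-assoc l v v⁻¹)
                   (trans (cong (l ⊗_) vv⁻¹≡1) (⊗-identityʳ l)))) l∈) }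

  T-⊗-swap : ∀ {l} → InFq q l → ∀ v x → T (v ⊗ (l ⊗ x)) ≡ l ⊗ T (v ⊗ x)
  T-⊗-swap {l} l∈ v x = trans (cong T (solve 3 (λ l v x → v :* (l :* x) := l :* (v :* x)) refl l v x)) (T-⊗ l∈ (v ⊗ x))

  T-⊕-⊗ : ∀ v w x → T ((v ⊕ w) ⊗ x) ≡ T (v ⊗ x) ⊕ T (w ⊗ x)
  T-⊕-⊗ v w x = trans (cong T (⊗-distribʳ x v w)) (T-⊕ _ _)

  T-⊗-assoc : ∀ {l} → InFq q l → ∀ v x → T (l ⊗ v ⊗ x) ≡ l ⊗ T (v ⊗ x)
  T-⊗-assoc {l} l∈ v x = trans (cong T (⊗-assoc l v x)) (T-⊗ l∈ (v ⊗ x))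

  T-⊖ : ∀ x → T (⊖ x) ≡ ⊖ T x
  T-⊖ x = ⊖-uniqueˡ _ _ (trans (sym (T-⊕ (⊖ x) x)) (trans (cong T (⊖-inverseˡ x)) T-0))

  H : Carrier → Carrier → ℤ
  H v x = δ (T (v ⊗ x)) 0#

  ∩size : Carrier → Carrier → ℤ
  ∩size v w = ∑ (λ x → H v x * H w x)

  -- Incidences of points with the q + 1 hyperplanes of the pencil, given by v and all w - lv with l
  -- in F_q, are counted in two ways. The factor q on the left avoids q^(m-2), whose exponent would
  -- be negative for m = 1.
  hyperplane-∩-size : ∀ {v w} → v ≢ 0# → ¬ Span v w → + q * ∩size v w ≡ + Q
  hyperplane-∩-size {v} {w} v≢0 w∉ = finish (+ q) (+ Q) (∩size v w) total
    where
    open ≡-Reasoning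
    member : Carrier → Carrier
    member l = w ⊕ ⊖ (l ⊗ v)
    T-member : ∀ {l} → InFq q l → ∀ x → T (member l ⊗ x) ≡ T (w ⊗ x) ⊕ ⊖ (l ⊗ T (v ⊗ x))
    T-member {l} l∈ x = trans (T-⊕-⊗ w (⊖ (l ⊗ v)) x) (cong (T (w ⊗ x) ⊕_)
      (trans (cong T (sym (⊖-distribˡ-⊗ (l ⊗ v) x))) (trans (T-⊖ (l ⊗ v ⊗ x)) (cong ⊖_ (T-⊗-assoc l∈ v x)))))
    member≢0 : ∀ {l} → InFq q l → member l ≢ 0#
    member≢0 {l} l∈ e = w∉ (l , l∈ , ⊕⊖≡0⇒≡ e)
    onHyperplane : ∀ a b → a * b + + 1 ≡ + 1 + a * (+ 1 * b)
    onHyperplane = solve-∀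
    offHyperplane : ∀ a b → + 1 + + 0 ≡ + 1 + a * (+ 0 * b)
    offHyperplane = solve-∀
    -- a point of both hyperplanes lies on all q + 1 members of the pencil, any other point on exactly one
    pencil : ∀ x → ∑ (λ l → φ l * H (member l) x) + H v x ≡ + 1 + + q * (H v x * H w x)
    pencil x with δ-cases (T (v ⊗ x)) 0#
    ... | inj₁ (Tvx≡0 , e) = trans (cong₂ _+_ (trans (∑-cong (λ l → φ-cong l (λ l∈ → δ-cong
              (λ r → trans (sym (reduce l∈)) r) (λ r → trans (reduce l∈) r)))) (∑φ* (H w x))) e)
            (trans (onHyperplane (+ q) (H w x)) (cong (λ d → + 1 + + q * (d * H w x)) (sym e)))
      where
      reduce : ∀ {l} → InFq q l → T (member l ⊗ x) ≡ T (w ⊗ x)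
      reduce {l} l∈ = trans (T-member l∈ x) (trans (cong (T (w ⊗ x) ⊕_) (trans (cong ⊖_ (trans (cong (l ⊗_) Tvx≡0) (⊗-zeroʳ l))) ⊖0≡0))
        (⊕-identityʳ _))
    ... | inj₂ (Tvx≢0 , e) = trans (cong₂ _+_ (trans (∑-cong single) (trans (∑-δˡ l₀ φ) (δ-≡ l₀∈))) e)
            (trans (offHyperplane (+ q) (H w x)) (cong (λ d → + 1 + + q * (d * H w x)) (sym e)))
      where
      a b a⁻¹ l₀ : Carrier
      a = T (v ⊗ x)
      b = T (w ⊗ x)
      a⁻¹ = proj₁ (Fq-inverse (T∈Fq (v ⊗ x)) Tvx≢0)
      l₀ = b ⊗ a⁻¹
      aa⁻¹≡1 : a ⊗ a⁻¹ ≡ 1#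
      aa⁻¹≡1 = proj₂ (proj₂ (Fq-inverse (T∈Fq (v ⊗ x)) Tvx≢0))
      l₀∈ : InFq q l₀
      l₀∈ = Fq-⊗ (T∈Fq (w ⊗ x)) (proj₁ (proj₂ (Fq-inverse (T∈Fq (v ⊗ x)) Tvx≢0)))
      al₀≡b : a ⊗ l₀ ≡ b
      al₀≡b = trans (solve 3 (λ a b c → a :* (b :* c) := b :* (a :* c)) refl a b a⁻¹) (trans (cong (b ⊗_) aa⁻¹≡1) (⊗-identityʳ b))
      single : ∀ l → φ l * H (member l) x ≡ δ l l₀ * φ l
      single l = trans (φ-cong l (λ l∈ → δ-cong
        (λ r → ⊗-cancelˡ a Tvx≢0 (trans (⊗-comm a l) (trans (sym (⊕⊖≡0⇒≡ (trans (sym (T-member l∈ x)) r))) (sym al₀≡b))))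
        (λ r → trans (T-member l∈ x) (≡⇒⊕⊖≡0 (sym (trans (⊗-comm l a) (trans (cong (a ⊗_) r) al₀≡b)))))))
        (ℤₚ.*-comm (φ l) (δ l l₀))
    pencilSize : ∑ (λ x → ∑ (λ l → φ l * H (member l) x)) ≡ + q * + Q
    pencilSize = begin
      ∑ (λ x → ∑ (λ l → φ l * H (member l) x))  ≡⟨ ∑-comm (λ x l → φ l * H (member l) x) ⟩
      ∑ (λ l → ∑ (λ x → φ l * H (member l) x))  ≡⟨ ∑-cong (λ l → ∑-*ˡ (φ l) (H (member l))) ⟩
      ∑ (λ l → φ l * ∑ (H (member l)))          ≡⟨ ∑-cong (λ l → φ-cong l (λ l∈ → hyperplaneSize (member≢0 l∈) Fq-0)) ⟩
      ∑ (λ l → φ l * + Q)                       ≡⟨ ∑φ* (+ Q) ⟩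
      + q * + Q                                 ∎
    total : + q * + Q + + Q ≡ + q * + Q * + 1 + + q * ∩size v w
    total = begin
      + q * + Q + + Q                                           ≡⟨ sym (cong₂ _+_ pencilSize (hyperplaneSize v≢0 Fq-0)) ⟩
      ∑ (λ x → ∑ (λ l → φ l * H (member l) x)) + ∑ (H v)        ≡⟨ sym (∑-distrib-+ _ _) ⟩
      ∑ (λ x → ∑ (λ l → φ l * H (member l) x) + H v x)          ≡⟨ ∑-cong pencil ⟩
      ∑ (λ x → + 1 + + q * (H v x * H w x))                     ≡⟨ ∑-distrib-+ _ _ ⟩
      ∑ (λ x → + 1) + ∑ (λ x → + q * (H v x * H w x))           ≡⟨ cong₂ _+_ (trans (∑-const (+ 1)) (cong (λ s → s * + 1) size≡qQ))
                                                                     (∑-*ˡ (+ q) (λ x → H v x * H w x)) ⟩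
      + q * + Q * + 1 + + q * ∩size v w                         ∎
    finish : ∀ a b h → a * b + b ≡ a * b * + 1 + a * h → a * h ≡ b
    finish a b h e = trans (dropˡ a b h) (trans (cong (λ s → s - a * b) (sym e)) (dropʳ a b))
      where
      dropˡ : ∀ a b h → a * h ≡ a * b * + 1 + a * h - a * b
      dropˡ = solve-∀
      dropʳ : ∀ a b → a * b + b - a * b ≡ b
      dropʳ = solve-∀

  -- The hypothesis gives one implication; applying it to the inverse of t gives the other.
  D-scale : ∀ {t} → InFq q t → t ≢ 0# → ∀ x → D (t ⊗ x) ≡ D x
  D-scale {t} t∈ t≢0 x with D x in Dx
  ... | true = D-invariant t x t∈ t≢0 Dx
  ... | false with D (t ⊗ x) in Dtx
  ... | false = refl
  ... | true  with t⁻¹ , t⁻¹∈ , tt⁻¹≡1 ← Fq-inverse t∈ t≢0 =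
    trans (sym (D-invariant t⁻¹ (t ⊗ x) t⁻¹∈ t⁻¹≢0 Dtx)) (trans (cong D t⁻¹tx≡x) Dx)
    where
    t⁻¹≢0 : t⁻¹ ≢ 0#
    t⁻¹≢0 e = 0≢1 (trans (sym (⊗-zeroʳ t)) (trans (cong (t ⊗_) (sym e)) tt⁻¹≡1))
    t⁻¹tx≡x : t⁻¹ ⊗ (t ⊗ x) ≡ x
    t⁻¹tx≡x = trans (solve 3 (λ a b c → b :* (a :* c) := a :* b :* c) refl t t⁻¹ x) (trans (cong (_⊗ x) tt⁻¹≡1) (⊗-identityˡ x))

  |D∩_|at : Carrier → Carrier → ℤ
  |D∩ v |at t = ∑ (λ x → d x * δ (T (v ⊗ x)) t)

  -- `N` counts D on the hyperplane, `M` on any one of the q - 1 other fibres. The character values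
  -- over F_q^* sum to -1, so the character sum is N - M, which is k - qM because k = N + (q-1)M.
  N M χ : Carrier → ℤ
  N v = |D∩ v |at 0#
  M v = |D∩ v |at 1#
  χ v = + k - + q * M v

  fibre≡M : ∀ v {t} → InFq q t → t ≢ 0# → |D∩ v |at t ≡ M v
  fibre≡M v {t} t∈ t≢0 = trans (sym (∑-scale t≢0 (λ x → d x * δ (T (v ⊗ x)) t))) (∑-cong (λ x → cong₂ _*_
    (cong ind (D-scale t∈ t≢0 x))
    (δ-cong (λ r → ⊗-cancelˡ t t≢0 (trans (sym (T-⊗-swap t∈ v x)) (trans r (sym (⊗-identityʳ t)))))
            (λ r → trans (T-⊗-swap t∈ v x) (trans (cong (t ⊗_) r) (⊗-identityʳ t))))))

  -- D is sorted by the value of the trace. Each of the q values is charged M, and the value zero is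
  -- then corrected by N - M.
  k≡qM+N-M : ∀ v → + k ≡ + q * M v + (N v - M v)
  k≡qM+N-M v = begin
    + k                                             ≡⟨ sym ∑d≡k ⟩
    ∑ d                                             ≡⟨ ∑-cong (λ x → sym (trans (cong (λ s → s * d x) (δ-≡ (T∈Fq (v ⊗ x)))) (ℤₚ.*-identityˡ (d x)))) ⟩
    ∑ (λ x → φ (T (v ⊗ x)) * d x)                   ≡⟨ ∑-cong (λ x → sym (∑-δˡ (T (v ⊗ x)) (λ t → φ t * d x))) ⟩
    ∑ (λ x → ∑ (λ t → δ t (T (v ⊗ x)) * (φ t * d x)))  ≡⟨ ∑-cong (λ x → ∑-cong (λ t → trans (rotate (δ t (T (v ⊗ x))) (φ t) (d x))
                                                            (cong (λ s → φ t * (d x * s)) (δ-cong sym sym)))) ⟩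
    ∑ (λ x → ∑ (λ t → φ t * (d x * δ (T (v ⊗ x)) t)))  ≡⟨ ∑-comm (λ x t → φ t * (d x * δ (T (v ⊗ x)) t)) ⟩
    ∑ (λ t → ∑ (λ x → φ t * (d x * δ (T (v ⊗ x)) t)))  ≡⟨ ∑-cong (λ t → ∑-*ˡ (φ t) (λ x → d x * δ (T (v ⊗ x)) t)) ⟩
    ∑ (λ t → φ t * |D∩ v |at t)                     ≡⟨ ∑-cong split ⟩
    ∑ (λ t → φ t * M v + δ t 0# * (N v - M v))      ≡⟨ ∑-distrib-+ (λ t → φ t * M v) (λ t → δ t 0# * (N v - M v)) ⟩
    ∑ (λ t → φ t * M v) + ∑ (λ t → δ t 0# * (N v - M v))  ≡⟨ cong₂ _+_ (∑φ* (M v)) (∑-δˡ 0# (λ _ → N v - M v)) ⟩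
    + q * M v + (N v - M v)                         ∎
    where
    open ≡-Reasoning
    rotate : ∀ a b c → a * (b * c) ≡ b * (c * a)
    rotate = solve-∀
    atZero : ∀ a b → + 1 * a ≡ + 1 * b + + 1 * (a - b)
    atZero = solve-∀
    elsewhere : ∀ a b c → a * b ≡ a * b + + 0 * c
    elsewhere = solve-∀
    split : ∀ t → φ t * |D∩ v |at t ≡ φ t * M v + δ t 0# * (N v - M v)
    split t with δ-cases t 0#
    ... | inj₁ (refl , e) = trans (cong (λ s → s * N v) (δ-≡ Fq-0)) (trans (atZero (N v) (M v))
            (sym (cong₂ (λ r s → r * M v + s * (N v - M v)) (δ-≡ Fq-0) e)))
    ... | inj₂ (t≢0 , e) = trans (φ-cong t (λ t∈ → fibre≡M v t∈ t≢0)) (trans (elsewhere (φ t) (M v) (N v - M v))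
            (cong (λ s → φ t * M v + s * (N v - M v)) (sym e)))

  -- Eliminates M: most of the later arguments determine or bound |D ∩ H_v|, and this turns the
  -- result into a statement on the eigenvalue.
  [q-1]χ≡qN-k : ∀ v → q-1 * χ v ≡ + q * N v - + k
  [q-1]χ≡qN-k v = trans (cong (λ s → q-1 * (s - + q * M v)) (k≡qM+N-M v))
    (trans (rearrange (+ q) (N v) (M v)) (cong (λ s → + q * N v - s) (sym (k≡qM+N-M v))))
    where
    rearrange : ∀ q N M → (q - + 1) * (q * M + (N - M) - q * M) ≡ q * N - (q * M + (N - M))
    rearrange = solve-∀

  -- The eigenvector q·1_H − 1 is the sum of the characters x ↦ Ψ(λvx) over λ ∈ F_q^*.
  χ-restrictedEigenvalue : ∀ {v} → v ≢ 0# → RestrictedEigenvalue D (χ v)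
  χ-restrictedEigenvalue {v} v≢0 = f , (0# , f0≢0) , trans (∑ℤ≡∑ f) ∑f≡0 , (λ x → trans (∑ℤ≡∑ _) (Af≡χf x))
    where
    open ≡-Reasoning
    f : Carrier → ℤ
    f x = + q * H v x - + 1
    f0≡q-1 : ∀ {x} → T (v ⊗ x) ≡ 0# → f x ≡ q-1
    f0≡q-1 r = cong (λ s → s - + 1) (trans (cong (λ s → + q * s) (δ-≡ r)) (ℤₚ.*-identityʳ (+ q)))
    f0≢0 : f 0# ≢ + 0
    f0≢0 e = ℕₚ.<-irrefl (sym (ℤₚ.+-injective (ℤₚ.i-j≡0⇒i≡j (+ q) (+ 1) (trans (sym (f0≡q-1 (trans (cong T (⊗-zeroʳ v)) T-0))) e)))) 1<q
    ∑f≡0 : ∑ f ≡ + 0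
    ∑f≡0 = trans (∑-distrib-- (λ x → + q * H v x) (λ _ → + 1)) (ℤₚ.i≡j⇒i-j≡0 (trans (∑-*ˡ (+ q) (H v))
      (trans (cong (λ s → + q * s) (hyperplaneSize v≢0 Fq-0)) (sym (trans (∑-const (+ 1)) (trans (ℤₚ.*-identityʳ (+ size)) size≡qQ))))))
    T-translate : ∀ x y → T (v ⊗ (x ⊕ ⊖ y)) ≡ T (v ⊗ x) ⊕ ⊖ T (v ⊗ y)
    T-translate x y = trans (cong T (⊗-distribˡ v x (⊖ y))) (trans (T-⊕ _ _) (cong (T (v ⊗ x) ⊕_)
      (trans (cong T (sym (⊖-distribʳ-⊗ v y))) (T-⊖ (v ⊗ y)))))
    expand : ∀ a b c → a * (b * c - + 1) ≡ b * (a * c) - a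
    expand = solve-∀
    -- Substituting x - y for y makes this a sum over D, whose value depends only on the trace of
    -- vx.
    Af : ∀ x → ∑ (λ y → A x y * f y) ≡ + q * |D∩ v |at (T (v ⊗ x)) - + k
    Af x = begin
      ∑ (λ y → A x y * f y)                 ≡⟨ ∑-cong (λ y → cong (λ s → A x y * f s) (sym (x⊖[x⊖y] x y))) ⟩
      ∑ (λ y → d (x ⊕ ⊖ y) * f (x ⊕ ⊖ (x ⊕ ⊖ y)))  ≡⟨ ∑-reflect x (λ y → d y * f (x ⊕ ⊖ y)) ⟩
      ∑ (λ y → d y * f (x ⊕ ⊖ y))           ≡⟨ ∑-cong (λ y → trans (cong (λ s → d y * (+ q * s - + 1)) (δ-cong
                                                 (λ r → sym (⊕⊖≡0⇒≡ (trans (sym (T-translate x y)) r)))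
                                                 (λ r → trans (T-translate x y) (≡⇒⊕⊖≡0 (sym r)))))
                                                 (expand (d y) (+ q) (δ (T (v ⊗ y)) (T (v ⊗ x))))) ⟩
      ∑ (λ y → + q * (d y * δ (T (v ⊗ y)) (T (v ⊗ x))) - d y)  ≡⟨ ∑-distrib-- (λ y → + q * (d y * δ (T (v ⊗ y)) (T (v ⊗ x)))) d ⟩
      ∑ (λ y → + q * (d y * δ (T (v ⊗ y)) (T (v ⊗ x)))) - ∑ d  ≡⟨ cong₂ _-_ (∑-*ˡ (+ q) (λ y → d y * δ (T (v ⊗ y)) (T (v ⊗ x)))) ∑d≡k ⟩
      + q * |D∩ v |at (T (v ⊗ x)) - + k     ∎
    negate : ∀ a b → a - b ≡ (b - a) * (- + 1)
    negate = solve-∀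
    -- On the hyperplane the value is qN - k = (q-1)χ, off it qM - k = -χ; the eigenvector has the
    -- values q - 1 and -1 there.
    Af≡χf : ∀ x → ∑ (λ y → A x y * f y) ≡ χ v * f x
    Af≡χf x with δ-cases (T (v ⊗ x)) 0#
    ... | inj₁ (r , _) = trans (Af x) (trans (cong (λ t → + q * |D∩ v |at t - + k) r) (trans (sym ([q-1]χ≡qN-k v))
            (trans (ℤₚ.*-comm q-1 (χ v)) (cong (λ s → χ v * s) (sym (f0≡q-1 r))))))
    ... | inj₂ (r , e) = trans (Af x) (trans (cong (λ s → + q * s - + k) (fibre≡M v (T∈Fq (v ⊗ x)) r))
            (trans (negate (+ q * M v) (+ k)) (cong (λ s → χ v * s) (sym (cong (λ s → s - + 1)
              (trans (cong (λ s → + q * s) e) (ℤₚ.*-zeroʳ (+ q))))))))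

-- Numerical contradictions

-- The alternatives (3a), (3b), (3c) with t for θ₀, q^m written as qQ, and the maximum in (3b) split
-- into two inequalities.
Bounds : (k q Q θ₁ θ₂ t : ℤ) → Set
Bounds k q Q θ₁ θ₂ t = k < q * Q + q * θ₂ - (q - + 1) * θ₁
                     ⊎ (q * t + θ₁ < k × q * t - (q - + 1) * θ₂ < k)
                     ⊎ t < Q + θ₂ - θ₁

≤-slack : ∀ {i j} → i ≤ j → + 0 ≤ j - i
≤-slack = ℤₚ.i≤j⇒0≤j-i

-- Over the integers a strict inequality has a gap of at least 1. Each one used therefore
-- contributes -1 to the constant of a certificate.
<-slack : ∀ {i j} → i < j → + 0 ≤ j - (+ 1 + i)
<-slack i<j = ℤₚ.i≤j⇒0≤j-i (ℤₚ.i<j⇒suc[i]≤j i<j)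

infixr 4 _⊞_
_⊞_ : ∀ {i j} → + 0 ≤ i → + 0 ≤ j → + 0 ≤ i + j
_⊞_ = ℤₚ.+-mono-≤

*-nonneg : ∀ {i j} → + 0 ≤ i → + 0 ≤ j → + 0 ≤ i * j
*-nonneg {i} {j} 0≤i 0≤j = subst (_≤ i * j) (ℤₚ.*-zeroʳ i) (ℤₚ.*-monoˡ-≤-nonNeg i {{ℤ.nonNegative 0≤i}} 0≤j)

-- Closes linear refutations: the hypotheses are added up as nonnegative slacks, and a ring identity
-- shows that the total is a negative constant.
negative : ∀ {s c} → + 0 ≤ s → s ≡ -[1+ c ] → ⊥
negative 0≤s refl with () ← 0≤s

-- With Q = θ₁ - θ₂, (3a) collapses to k < θ₁ and (3c) to t < 0. In (3b), qt + θ₁ < k ≤ θ₁ - qθ₂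
-- contradicts -θ₂ ≤ t.
bounds-refute-difference : ∀ k q Q θ₁ θ₂ t → + 0 ≤ q → + 0 < θ₁ → θ₁ < k → θ₁ ≤ t → - θ₂ ≤ t →
  Q ≡ θ₁ - θ₂ → k ≤ Q - (q - + 1) * θ₂ → ¬ Bounds k q Q θ₁ θ₂ t
bounds-refute-difference k q _ θ₁ θ₂ t 0≤q 0<θ₁ θ₁<k θ₁≤t -θ₂≤t refl k≤ =
  [ (λ a → negative (<-slack a ⊞ <-slack θ₁<k) (first k q θ₁ θ₂))
  , [ (λ (b , _) → negative (<-slack b ⊞ ≤-slack k≤ ⊞ *-nonneg 0≤q (≤-slack -θ₂≤t)) (second k q θ₁ θ₂ t))
    , (λ c → negative (<-slack c ⊞ ≤-slack θ₁≤t ⊞ <-slack 0<θ₁) (third θ₁ θ₂ t)) ]′ ]′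
  where
  first : ∀ k q θ₁ θ₂ → q * (θ₁ - θ₂) + q * θ₂ - (q - + 1) * θ₁ - (+ 1 + k) + (k - (+ 1 + θ₁)) ≡ -[1+ 1 ]
  first = solve-∀
  second : ∀ k q θ₁ θ₂ t → k - (+ 1 + (q * t + θ₁)) + (θ₁ - θ₂ - (q - + 1) * θ₂ - k + q * (t - - θ₂)) ≡ -[1+ 0 ]
  second = solve-∀
  third : ∀ θ₁ θ₂ t → θ₁ - θ₂ + θ₂ - θ₁ - (+ 1 + t) + (t - θ₁ + (θ₁ - (+ 1 + + 0))) ≡ -[1+ 1 ]
  third = solve-∀

-- For q = 2 and Q ≤ -2θ₂, (3a) gives Q - χ < Q - θ₁, so χ > θ₁. In (3b), 2t - θ₂ < Q - χ ≤ -3θ₂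
-- gives t < -θ₂, and so does (3c), since θ₁ > 0.
bounds-refute-binary : ∀ k q Q θ₁ θ₂ t χ → q ≡ + 2 → + 0 < θ₁ → θ₂ < + 0 → θ₁ ≤ t → - θ₂ ≤ t →
  χ ≡ θ₁ ⊎ χ ≡ θ₂ → k ≡ Q - χ → Q ≤ - (q * θ₂) → ¬ Bounds k q Q θ₁ θ₂ t
bounds-refute-binary _ q Q θ₁ θ₂ t χ q≡2 0<θ₁ θ₂<0 θ₁≤t -θ₂≤t χ∈ refl Q≤ =
  [ refuteFirst χ∈
  , [ (λ (_ , b) → negative (<-slack b ⊞ ≤-slack Q≤ ⊞ ≤-slack (θ₂≤χ χ∈) ⊞ ≤-slack -θ₂≤t ⊞ ≤-slack -θ₂≤t) (second q Q θ₂ t χ q≡2))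
    , (λ c → negative (<-slack c ⊞ ≤-slack Q≤ ⊞ ≤-slack -θ₂≤t ⊞ <-slack 0<θ₁) (third q Q θ₁ θ₂ t q≡2)) ]′ ]′
  where
  -- These are polynomial identities only at q = 2, so that value is substituted before they are
  -- checked.
  first₁ : ∀ q Q θ₁ θ₂ → q ≡ + 2 → q * Q + q * θ₂ - (q - + 1) * θ₁ - (+ 1 + (Q - θ₁)) + (- (q * θ₂) - Q) ≡ -[1+ 0 ]
  first₁ _ Q θ₁ θ₂ refl = at2 Q θ₁ θ₂
    where
    at2 : ∀ Q θ₁ θ₂ → + 2 * Q + + 2 * θ₂ - (+ 2 - + 1) * θ₁ - (+ 1 + (Q - θ₁)) + (- (+ 2 * θ₂) - Q) ≡ -[1+ 0 ]
    at2 = solve-∀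
  first₂ : ∀ q Q θ₁ θ₂ → q ≡ + 2 → q * Q + q * θ₂ - (q - + 1) * θ₁ - (+ 1 + (Q - θ₂)) +
    (- (q * θ₂) - Q + (θ₁ - (+ 1 + + 0) + (+ 0 - (+ 1 + θ₂)))) ≡ -[1+ 2 ]
  first₂ _ Q θ₁ θ₂ refl = at2 Q θ₁ θ₂
    where
    at2 : ∀ Q θ₁ θ₂ → + 2 * Q + + 2 * θ₂ - (+ 2 - + 1) * θ₁ - (+ 1 + (Q - θ₂)) +
      (- (+ 2 * θ₂) - Q + (θ₁ - (+ 1 + + 0) + (+ 0 - (+ 1 + θ₂)))) ≡ -[1+ 2 ]
    at2 = solve-∀
  second : ∀ q Q θ₂ t χ → q ≡ + 2 →
    (Q - χ) - (+ 1 + (q * t - (q - + 1) * θ₂)) + (- (q * θ₂) - Q + (χ - θ₂ + ((t - - θ₂) + (t - - θ₂)))) ≡ -[1+ 0 ]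
  second _ Q θ₂ t χ refl = at2 Q θ₂ t χ
    where
    at2 : ∀ Q θ₂ t χ → (Q - χ) - (+ 1 + (+ 2 * t - (+ 2 - + 1) * θ₂)) + (- (+ 2 * θ₂) - Q + (χ - θ₂ + ((t - - θ₂) + (t - - θ₂)))) ≡ -[1+ 0 ]
    at2 = solve-∀
  third : ∀ q Q θ₁ θ₂ t → q ≡ + 2 → Q + θ₂ - θ₁ - (+ 1 + t) + (- (q * θ₂) - Q + (t - - θ₂ + (θ₁ - (+ 1 + + 0)))) ≡ -[1+ 1 ]
  third _ Q θ₁ θ₂ t refl = at2 Q θ₁ θ₂ t
    where
    at2 : ∀ Q θ₁ θ₂ t → Q + θ₂ - θ₁ - (+ 1 + t) + (- (+ 2 * θ₂) - Q + (t - - θ₂ + (θ₁ - (+ 1 + + 0)))) ≡ -[1+ 1 ]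
    at2 = solve-∀
  θ₂≤χ : χ ≡ θ₁ ⊎ χ ≡ θ₂ → θ₂ ≤ χ
  θ₂≤χ (inj₁ refl) = ℤₚ.<⇒≤ (ℤₚ.<-trans θ₂<0 0<θ₁)
  θ₂≤χ (inj₂ refl) = ℤₚ.≤-refl
  refuteFirst : χ ≡ θ₁ ⊎ χ ≡ θ₂ → ¬ Q - χ < q * Q + q * θ₂ - (q - + 1) * θ₁
  refuteFirst (inj₁ refl) a = negative (<-slack a ⊞ ≤-slack Q≤) (first₁ q Q θ₁ θ₂ q≡2)
  refuteFirst (inj₂ refl) a = negative (<-slack a ⊞ ≤-slack Q≤ ⊞ <-slack 0<θ₁ ⊞ <-slack θ₂<0) (first₂ q Q θ₁ θ₂ q≡2)

-- Subtracting the first two equations gives (q-1)(a-b) = q(Q-h), and with Q = qh this is (q-1)Q.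
differenceOfEigenvalues : ∀ q Q k a b x y h .{{_ : ℤ.NonZero (q - + 1)}} →
  (q - + 1) * a ≡ q * x - k → (q - + 1) * b ≡ q * y - k → q * h ≡ Q → x - y ≡ Q - h → a - b ≡ Q
differenceOfEigenvalues q _ k a b x y h ea eb refl e = ℤₚ.*-cancelˡ-≡ (q - + 1) (a - b) (q * h)
  (trans (spread q a b) (trans (cong₂ _-_ ea eb) (trans (factor q k x y) (trans (cong (λ s → q * s) e) (regroup q h)))))
  where
  spread : ∀ q a b → (q - + 1) * (a - b) ≡ (q - + 1) * a - (q - + 1) * b
  spread = solve-∀
  factor : ∀ q k x y → q * x - k - (q * y - k) ≡ q * (x - y)
  factor = solve-∀
  regroup : ∀ q h → q * (q * h - h) ≡ (q - + 1) * (q * h)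
  regroup = solve-∀

binary-fullWeight : ∀ q h Q x → q ≡ + 2 → q * h ≡ Q → x ≡ Q - h → q * x ≡ Q
binary-fullWeight _ h _ _ refl refl refl = identity h
  where
  identity : ∀ h → + 2 * (+ 2 * h - h) ≡ + 2 * h
  identity = solve-∀

binary-k≡Q-χ : ∀ q k Q x a → q ≡ + 2 → (q - + 1) * a ≡ q * x - k → q * x ≡ Q → k ≡ Q - a
binary-k≡Q-χ q k Q x a q≡2 ea ex = trans (isolate k Q) (cong (λ s → Q - s)
  (trans (cong (λ s → s - k) (sym ex)) (trans (sym ea) (trans (cong (λ s → (s - + 1) * a) q≡2) (ℤₚ.*-identityˡ a)))))
  where
  isolate : ∀ k Q → k ≡ Q - (Q - k)
  isolate = solve-∀

-- At q = 2 the eigenvalues are a = 2y - k and b = 2z - k, so 2θ ≤ a + b = 2(y+z) - 2k ≤ -2x = -Q.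
binary-Q≤-2θ : ∀ q k Q x y z a b θ → q ≡ + 2 → (q - + 1) * a ≡ q * y - k → (q - + 1) * b ≡ q * z - k → q * x ≡ Q →
  y + z ≤ k - x → θ ≤ a → θ ≤ b → Q ≤ - (q * θ)
binary-Q≤-2θ q k _ x y z a b θ q≡2 ea eb refl y+z≤ θ≤a θ≤b = ℤₚ.0≤i-j⇒j≤i (subst (+ 0 ≤_) combined
  (≤-slack θ≤a ⊞ ≤-slack θ≤b ⊞ ≤-slack y+z≤ ⊞ ≤-slack y+z≤))
  where
  atTwo : ∀ {c w} → (q - + 1) * c ≡ q * w - k → c ≡ + 2 * w - k
  atTwo {c} {w} e = trans (sym (ℤₚ.*-identityˡ c)) (subst (λ s → (s - + 1) * c ≡ s * w - k) q≡2 e)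
  identity : ∀ k x y z θ → (+ 2 * y - k - θ) + ((+ 2 * z - k - θ) + ((k - x - (y + z)) + (k - x - (y + z)))) ≡ - (+ 2 * θ) - + 2 * x
  identity = solve-∀
  combined : (a - θ) + ((b - θ) + ((k - x - (y + z)) + (k - x - (y + z)))) ≡ - (q * θ) - q * x
  combined = trans (cong₂ (λ s t → (s - θ) + ((t - θ) + ((k - x - (y + z)) + (k - x - (y + z))))) (atTwo ea) (atTwo eb))
    (trans (identity k x y z θ) (cong (λ s → - (s * θ) - s * x) (sym q≡2)))

-- Minimality

module Minimality (K : FiniteField) {p : ℕ} (pp : Prime p) {e : ℕ} (e≥1 : e ≥ 1) (n : ℕ)
                  (size≡q^m : FiniteField.size K ≡ (p ^ e) ^ suc n)
                  (D : FF.Subset K) {k l μ : ℕ} (pds : FF.IsPDS K D ((p ^ e) ^ suc n) k l μ)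
                  (D-invariant : FF.FqInvariant K (p ^ e) D)
                  {θ₁ θ₂ : ℤ} (θ₁-restricted : FF.RestrictedEigenvalue K D θ₁) (θ₂-restricted : FF.RestrictedEigenvalue K D θ₂)
                  (0<θ₁ : + 0 < θ₁) (θ₂<0 : θ₂ < + 0)
                  (k-θ₂≢q^m : + k - θ₂ ≢ + (p ^ e) * + ((p ^ e) ^ n))
                  (θ₁<k : θ₁ < + k) (-[q-1]θ₂<k : - (+ (p ^ e) - + 1) * θ₂ < + k)
                  {t : ℤ} (θ₁≤t : θ₁ ≤ t) (-θ₂≤t : - θ₂ ≤ t)
                  (bounds : Bounds (+ k) (+ (p ^ e)) (+ ((p ^ e) ^ n)) θ₁ θ₂ t) where
  open FF K using (fD; IsMinimalCode)
  open Counting K pp e≥1 n size≡q^m D pds D-invariant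

  private
    instance
      q-1≢0 : ℤ.NonZero q-1
      q-1≢0 = ℤ.≢-nonZero (λ r → ℕₚ.<-irrefl (sym (ℤₚ.+-injective (ℤₚ.i-j≡0⇒i≡j (+ q) (+ 1) r))) 1<q)

  fD-∈ : ∀ {x} → D x ≡ true → fD D x ≡ 1#
  fD-∈ {x} Dx with D x | Dx
  ... | true | _ = refl

  fD-∉ : ∀ {x} → D x ≡ false → fD D x ≡ 0#
  fD-∉ {x} Dx with D x | Dx
  ... | false | _ = refl

  D⇒≢0 : ∀ {x} → D x ≡ true → x ≢ 0#
  D⇒≢0 Dx refl with () ← trans (sym D0≡false) Dx

  T[v0]≡0 : ∀ {v x} → x ≡ 0# → T (v ⊗ x) ≡ 0#
  T[v0]≡0 {v} refl = trans (cong T (⊗-zeroʳ v)) T-0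

  T[0x]≡0 : ∀ {v x} → v ≡ 0# → T (v ⊗ x) ≡ 0#
  T[0x]≡0 {_} {x} refl = trans (cong T (⊗-zeroˡ x)) T-0

  ⊖-nonzero : ∀ {x} → x ≢ 0# → ⊖ x ≢ 0#
  ⊖-nonzero {x} x≢0 e = x≢0 (trans (sym (⊖-involutive x)) (trans (cong ⊖_ e) ⊖0≡0))

  T-⊕-reduceˡ : ∀ {v} w x → T (v ⊗ x) ≡ 0# → T ((w ⊕ v) ⊗ x) ≡ T (w ⊗ x)
  T-⊕-reduceˡ {v} w x r = trans (T-⊕-⊗ w v x) (trans (cong (T (w ⊗ x) ⊕_) r) (⊕-identityʳ _))

  T-⊕-reduceʳ : ∀ {w} v x → T (w ⊗ x) ≡ 0# → T ((w ⊕ v) ⊗ x) ≡ T (v ⊗ x)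
  T-⊕-reduceʳ {w} v x r = trans (T-⊕-⊗ w v x) (trans (cong (_⊕ T (v ⊗ x)) r) (⊕-identityˡ _))

  ¬span⇒⊕≢0 : ∀ {v w} → ¬ Span v w → w ⊕ v ≢ 0#
  ¬span⇒⊕≢0 {v} {w} w∉ r = w∉ (⊖ 1# , Fq-⊖ Fq-1 ,
    trans (⊖-uniqueˡ w v r) (trans (cong ⊖_ (sym (⊗-identityˡ v))) (⊖-distribˡ-⊗ 1# v)))

  χ∈ : ∀ {v} → v ≢ 0# → χ v ≡ θ₁ ⊎ χ v ≡ θ₂
  χ∈ v≢0 = restrictedEigenvalue-two (λ { refl → ℤₚ.<-asym 0<θ₁ θ₂<0 }) θ₁-restricted θ₂-restricted (χ-restrictedEigenvalue v≢0)

  θ₂≤χ : ∀ {v} → v ≢ 0# → θ₂ ≤ χ v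
  θ₂≤χ v≢0 = [ (λ r → subst (θ₂ ≤_) (sym r) (ℤₚ.<⇒≤ (ℤₚ.<-trans θ₂<0 0<θ₁))) , (λ r → ℤₚ.≤-reflexive (sym r)) ]′ (χ∈ v≢0)

  -- Equality would mean M = 0, that is, D inside the hyperplane of v; both eigenvalues are below k.
  χ≢k : ∀ {v} → v ≢ 0# → χ v ≢ + k
  χ≢k v≢0 χ≡k = [ (λ r → ℤₚ.<-irrefl (trans (sym r) χ≡k) θ₁<k)
                , (λ r → ℤₚ.<-irrefl (trans (sym r) χ≡k) (ℤₚ.<-trans θ₂<0 (ℤₚ.<-trans 0<θ₁ θ₁<k))) ]′ (χ∈ v≢0)

  k≤size : + k ≤ + q * + Q
  k≤size = subst₂ _≤_ ∑d≡k (trans (∑-const (+ 1)) (trans (ℤₚ.*-identityʳ (+ size)) size≡qQ)) (∑-mono d≤1)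
    where
    d≤1 : ∀ x → d x ≤ + 1
    d≤1 x = [ (λ (_ , r) → ℤₚ.≤-reflexive r) , (λ (_ , r) → subst (_≤ + 1) (sym r) (+≤+ z≤n)) ]′ (D-cases x)

  -- Equality would mean M = Q, that is, D containing everything off the hyperplane. The value k -
  -- q^m is not positive, which rules out θ₁, and hypothesis (1) rules out θ₂.
  χ≢k-size : ∀ {v} → v ≢ 0# → χ v ≢ + k - + q * + Q
  χ≢k-size v≢0 χ≡ = [ (λ r → ℤₚ.<⇒≱ 0<θ₁ (subst (_≤ + 0) (trans (sym χ≡) r) (ℤₚ.i≤j⇒i-j≤0 k≤size)))
                    , (λ r → k-θ₂≢q^m (trans (cong (λ s → + k - s) (trans (sym r) χ≡)) (sym (isolate (+ q * + Q) (+ k))))) ]′ (χ∈ v≢0)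
    where
    isolate : ∀ a b → a ≡ b - (b - a)
    isolate = solve-∀

  -- If D missed the hyperplane, k would be -(q-1)χ. For χ = θ₁ this is negative, and for χ = θ₂ it
  -- violates the second half of (2).
  N≢0 : ∀ {v} → v ≢ 0# → N v ≢ + 0
  N≢0 {v} v≢0 Nv≡0 = [ (λ r → negative (<-slack θ₁<k ⊞ <-slack 0<θ₁ ⊞ *-nonneg 0≤q-1 (ℤₚ.<⇒≤ 0<θ₁))
        (trans (collect (+ k) θ₁ (q-1 * θ₁)) (cong (λ s → s - + 2) (trans (cong (λ s → + k + q-1 * s) (sym r)) k+[q-1]χ≡0))))
    , (λ r → ℤₚ.<-irrefl (trans (sym (ℤₚ.neg-distribˡ-* q-1 θ₂)) (trans (cong (λ s → - (q-1 * s)) (sym r)) (sym k≡))) -[q-1]θ₂<k) ]′ (χ∈ v≢0)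
    where
    0≤q-1 : + 0 ≤ q-1
    0≤q-1 = ℤₚ.i≤j⇒0≤j-i (+≤+ (ℕₚ.<⇒≤ 1<q))
    collect : ∀ k θ s → k - (+ 1 + θ) + (θ - (+ 1 + + 0) + s) ≡ k + s - + 2
    collect = solve-∀
    negZero : ∀ q k → q * + 0 - k ≡ - k
    negZero = solve-∀
    [q-1]χ≡-k : q-1 * χ v ≡ - + k
    [q-1]χ≡-k = trans ([q-1]χ≡qN-k v) (trans (cong (λ s → + q * s - + k) Nv≡0) (negZero (+ q) (+ k)))
    k+[q-1]χ≡0 : + k + q-1 * χ v ≡ + 0
    k+[q-1]χ≡0 = trans (cong (λ s → + k + s) [q-1]χ≡-k) (ℤₚ.+-inverseʳ (+ k))
    k≡ : + k ≡ - (q-1 * χ v)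
    k≡ = trans (sym (ℤₚ.neg-involutive (+ k))) (cong -_ (sym [q-1]χ≡-k))

  q*Q≢Q : + q * + Q ≢ + Q
  q*Q≢Q r = ℕₚ.<-irrefl (sym (ℤₚ.+-injective (ℤₚ.*-cancelʳ-≡ (+ q) (+ 1) (+ Q) {{ℤ.≢-nonZero Q≢0}}
    (trans r (sym (ℤₚ.*-identityˡ (+ Q))))))) 1<q
    where
    Q≢0 : + Q ≢ + 0
    Q≢0 r′ = ℕₚ.<-irrefl (sym (ℤₚ.+-injective r′)) Q>0

  -- If w were independent of v, the intersection would be all of H_v, of size Q, although q times
  -- its size is only Q.
  hyperplane-⊆⇒span : ∀ {v w} → v ≢ 0# → (∀ x → T (v ⊗ x) ≡ 0# → T (w ⊗ x) ≡ 0#) → Span v w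
  hyperplane-⊆⇒span {v} {w} v≢0 ⊆ with span? v≢0 w
  ... | yes w∈ = w∈
  ... | no  w∉ = ⊥-elim (q*Q≢Q (subst (λ s → + q * s ≡ + Q) ∩≡ (hyperplane-∩-size v≢0 w∉)))
    where
    pointwise : ∀ x → H v x * H w x ≡ H v x
    pointwise x with δ-cases (T (v ⊗ x)) 0#
    ... | inj₁ (r , e) rewrite e = trans (ℤₚ.*-identityˡ (H w x)) (δ-≡ (⊆ x r))
    ... | inj₂ (_ , e) rewrite e = refl
    ∩≡ : ∩size v w ≡ + Q
    ∩≡ = trans (∑-cong pointwise) (hyperplaneSize v≢0 Fq-0)

  -- Here w is what remains of the second word after a multiple of the first, whose D-coefficient is
  -- u, has been subtracted. Refuting w ≠ 0 proves that the words are proportional.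
  module ZeroSet {u v w} (u∈ : InFq q u) (u≢0 : u ≢ 0#) (w≢0 : w ≢ 0#)
                 (zeros : ∀ x → x ≢ 0# → u ⊗ fD D x ⊕ T (v ⊗ x) ≡ 0# → T (w ⊗ x) ≡ 0#) where

    outsideD : ∀ {x} → D x ≡ false → T (v ⊗ x) ≡ 0# → T (w ⊗ x) ≡ 0#
    outsideD {x} Dx Tvx≡0 with x ≟ 0#
    ... | yes x≡0 = T[v0]≡0 x≡0
    ... | no  x≢0 = zeros x x≢0 (trans (cong₂ _⊕_ (trans (cong (u ⊗_) (fD-∉ Dx)) (⊗-zeroʳ u)) Tvx≡0) (⊕-identityˡ 0#))

    -- some multiple sx has u + Tr(v(sx)) = 0
    insideD : ∀ {x} → D x ≡ true → T (v ⊗ x) ≢ 0# → T (w ⊗ x) ≡ 0#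
    insideD {x} Dx a≢0 with a⁻¹ , a⁻¹∈ , aa⁻¹≡1 ← Fq-inverse (T∈Fq (v ⊗ x)) a≢0 =
      x⊗y≡0⇒y≡0 s≢0 (trans (sym (T-⊗-swap s∈ w x)) (zeros (s ⊗ x) (⊗-nonzero s≢0 (D⇒≢0 Dx)) sx-zero))
      where
      s a : Carrier
      s = ⊖ u ⊗ a⁻¹
      a = T (v ⊗ x)
      a⁻¹≢0 : a⁻¹ ≢ 0#
      a⁻¹≢0 r = 0≢1 (trans (sym (⊗-zeroʳ a)) (trans (cong (a ⊗_) (sym r)) aa⁻¹≡1))
      s≢0 : s ≢ 0#
      s≢0 = ⊗-nonzero (⊖-nonzero u≢0) a⁻¹≢0
      s∈ : InFq q s
      s∈ = Fq-⊗ (Fq-⊖ u∈) a⁻¹∈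
      sa≡⊖u : s ⊗ a ≡ ⊖ u
      sa≡⊖u = trans (solve 3 (λ b c d → b :* c :* d := b :* (d :* c)) refl (⊖ u) a⁻¹ a)
        (trans (cong (⊖ u ⊗_) aa⁻¹≡1) (⊗-identityʳ (⊖ u)))
      sx-zero : u ⊗ fD D (s ⊗ x) ⊕ T (v ⊗ (s ⊗ x)) ≡ 0#
      sx-zero = trans (cong₂ _⊕_ (trans (cong (u ⊗_) (fD-∈ (trans (D-scale s∈ s≢0 x) Dx))) (⊗-identityʳ u))
        (trans (T-⊗-swap s∈ v x) sa≡⊖u)) (⊖-inverseʳ u)

    -- All points outside D now lie on H_w, so D contains the whole fibre over 1 and M w = Q.
    v≡0⇒⊥ : v ≡ 0# → ⊥
    v≡0⇒⊥ v≡0 = χ≢k-size w≢0 (cong (λ s → + k - + q * s) (trans (∑-cong pointwise) (hyperplaneSize w≢0 Fq-1)))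
      where
      pointwise : ∀ x → d x * δ (T (w ⊗ x)) 1# ≡ δ (T (w ⊗ x)) 1#
      pointwise x with D-cases x
      ... | inj₁ (_  , e) rewrite e = ℤₚ.*-identityˡ _
      ... | inj₂ (Dx , e) rewrite e = sym (δ-≢ (λ r → 0≢1 (trans (sym (outsideD Dx (T[0x]≡0 v≡0))) r)))

    -- Here w is a nonzero multiple of v, so a point of D off H_v would by `insideD` also lie on
    -- H_v. Hence D lies in H_v and M v = 0.
    span⇒⊥ : v ≢ 0# → Span v w → ⊥
    span⇒⊥ v≢0 (s , s∈ , w≡sv) = χ≢k v≢0 (trans (cong (λ r → + k - + q * r) Mv≡0) (identity (+ q) (+ k)))
      where
      s≢0 : s ≢ 0#
      s≢0 s≡0 = w≢0 (trans w≡sv (trans (cong (_⊗ v) s≡0) (⊗-zeroˡ v)))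
      identity : ∀ q k → k - q * + 0 ≡ k
      identity = solve-∀
      pointwise : ∀ x → d x * δ (T (v ⊗ x)) 1# ≡ + 0
      pointwise x with D-cases x | δ-cases (T (v ⊗ x)) 1#
      ... | inj₂ (_  , e) | _            rewrite e = refl
      ... | inj₁ (_  , e) | inj₂ (_ , f) rewrite e | f = refl
      ... | inj₁ (Dx , _) | inj₁ (r , _) = ⊥-elim (Tvx≢0 (x⊗y≡0⇒y≡0 s≢0
              (trans (sym (T-⊗-assoc s∈ v x)) (trans (cong (λ y → T (y ⊗ x)) (sym w≡sv)) (insideD Dx Tvx≢0)))))
        where
        Tvx≢0 : T (v ⊗ x) ≢ 0#
        Tvx≢0 r′ = 0≢1 (trans (sym r′) r)
      Mv≡0 : M v ≡ + 0
      Mv≡0 = trans (∑-cong pointwise) (trans (∑-const (+ 0)) (ℤₚ.*-zeroʳ (+ size)))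

    independent⇒⊥ : v ≢ 0# → ¬ Span v w → ⊥
    independent⇒⊥ v≢0 w∉ = conclude (χ∈ v≢0) (χ∈ z≢0)
      where
      -- On H_v the traces of zx and wx agree. At a point of D off H_v the trace of wx vanishes, so
      -- zx has the nonzero trace of vx. Thus D ∩ H_z lies in H_v ∩ H_w, and N v - N z counts the
      -- points of H_v off H_w.
      z : Carrier
      z = w ⊕ v
      z≢0 : z ≢ 0#
      z≢0 = ¬span⇒⊕≢0 w∉
      h : ℤ
      h = ∩size v w
      qh≡Q : + q * h ≡ + Q
      qh≡Q = hyperplane-∩-size v≢0 w∉
      Nz-pointwise : ∀ x → d x * H z x ≤ H v x * H w x
      Nz-pointwise x with D-cases x | δ-cases (T (z ⊗ x)) 0#
      ... | inj₂ (_ , e)  | _            rewrite e = *-nonneg (δ-≥0 (T (v ⊗ x)) 0#) (δ-≥0 (T (w ⊗ x)) 0#)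
      ... | inj₁ (_ , e)  | inj₂ (_ , f) rewrite e | f = *-nonneg (δ-≥0 (T (v ⊗ x)) 0#) (δ-≥0 (T (w ⊗ x)) 0#)
      ... | inj₁ (Dx , e) | inj₁ (r , f) with δ-cases (T (v ⊗ x)) 0#
      ...   | inj₂ (Tvx≢0 , _) = ⊥-elim (Tvx≢0 (trans (sym (T-⊕-reduceʳ v x (insideD Dx Tvx≢0))) r))
      ...   | inj₁ (Tvx≡0 , g) rewrite e | f | g | δ-≡ (trans (sym (T-⊕-reduceˡ w x Tvx≡0)) r) = ℤₚ.≤-refl
      Nz≤h : N z ≤ h
      Nz≤h = ∑-mono Nz-pointwise
      Nv-Nz-pointwise : ∀ x → d x * H v x - d x * H z x ≡ H v x - H v x * H w x
      Nv-Nz-pointwise x = byCases (D-cases x) (δ-cases (T (v ⊗ x)) 0#)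
        where
        inD-onH : ∀ {a b} c e → a ≡ + 1 → b ≡ + 1 → c ≡ e → a * b - a * c ≡ b - b * e
        inD-onH c _ refl refl refl = refl
        inD-offH : ∀ {a b} c e → a ≡ + 1 → b ≡ + 0 → c ≡ + 0 → a * b - a * c ≡ b - b * e
        inD-offH _ e refl refl refl = refl
        outD-onH : ∀ {a b} c e → a ≡ + 0 → b ≡ + 1 → e ≡ + 1 → a * b - a * c ≡ b - b * e
        outD-onH c _ refl refl refl = refl
        outD-offH : ∀ {a b} c e → a ≡ + 0 → b ≡ + 0 → a * b - a * c ≡ b - b * e
        outD-offH c e refl refl = refl
        byCases : _ → _ → d x * H v x - d x * H z x ≡ H v x - H v x * H w x
        byCases (inj₁ (Dx , e)) (inj₁ (Tvx≡0 , f)) = inD-onH (H z x) (H w x) e f (δ-cong (trans (sym (T-⊕-reduceˡ w x Tvx≡0))) (trans (T-⊕-reduceˡ w x Tvx≡0)))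
        byCases (inj₁ (Dx , e)) (inj₂ (Tvx≢0 , f)) = inD-offH (H z x) (H w x) e f (δ-≢ (Tvx≢0 ∘ trans (sym (T-⊕-reduceʳ v x (insideD Dx Tvx≢0)))))
        byCases (inj₂ (Dx , e)) (inj₁ (Tvx≡0 , f)) = outD-onH (H z x) (H w x) e f (δ-≡ (outsideD Dx Tvx≡0))
        byCases (inj₂ (Dx , e)) (inj₂ (Tvx≢0 , f)) = outD-offH (H z x) (H w x) e f
      Nv-Nz : N v - N z ≡ + Q - h
      Nv-Nz = trans (sym (∑-distrib-- (λ x → d x * H v x) (λ x → d x * H z x))) (trans (∑-cong Nv-Nz-pointwise) (trans (∑-distrib-- (H v) (λ x → H v x * H w x))
        (cong (λ s → s - h) (hyperplaneSize v≢0 Fq-0))))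
      χv-χz≡Q : χ v - χ z ≡ + Q
      χv-χz≡Q = differenceOfEigenvalues (+ q) (+ Q) (+ k) (χ v) (χ z) (N v) (N z) h ([q-1]χ≡qN-k v) ([q-1]χ≡qN-k z) qh≡Q Nv-Nz
      +0<Q : + 0 < + Q
      +0<Q = ℤ.+<+ Q>0
      -- From N z ≤ h follows (q-1)θ₂ = qN z - k ≤ qh - k = Q - k.
      k≤ : χ z ≡ θ₂ → + k ≤ + Q - q-1 * θ₂
      k≤ r = ℤₚ.0≤i-j⇒j≤i (subst (+ 0 ≤_) (trans (identity (+ q) h (N z) (+ k))
        (cong₂ (λ s s′ → s - s′ - + k) qh≡Q (trans (sym ([q-1]χ≡qN-k z)) (cong (λ s → q-1 * s) r))))
        (*-nonneg {+ q} (+≤+ z≤n) (≤-slack Nz≤h)))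
        where
        identity : ∀ q h x k → q * (h - x) ≡ q * h - (q * x - k) - k
        identity = solve-∀
      conclude : χ v ≡ θ₁ ⊎ χ v ≡ θ₂ → χ z ≡ θ₁ ⊎ χ z ≡ θ₂ → ⊥
      conclude (inj₁ r) (inj₂ s) = bounds-refute-difference (+ k) (+ q) (+ Q) θ₁ θ₂ t (+≤+ z≤n) 0<θ₁ θ₁<k θ₁≤t -θ₂≤t
        (trans (sym χv-χz≡Q) (cong₂ _-_ r s)) (k≤ s) bounds
      conclude (inj₁ r) (inj₁ s) = ℤₚ.<-irrefl (trans (sym (ℤₚ.i≡j⇒i-j≡0 (trans r (sym s)))) χv-χz≡Q) +0<Q
      conclude (inj₂ r) (inj₂ s) = ℤₚ.<-irrefl (trans (sym (ℤₚ.i≡j⇒i-j≡0 (trans r (sym s)))) χv-χz≡Q) +0<Q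
      conclude (inj₂ r) (inj₁ s) = ℤₚ.<-asym +0<Q (subst (_< + 0) (trans (sym (cong₂ _-_ r s)) χv-χz≡Q)
        (ℤₚ.+-mono-<-≤ θ₂<0 (ℤₚ.neg-mono-≤ (ℤₚ.<⇒≤ 0<θ₁))))

    contradiction : ⊥
    contradiction with v ≟ 0#
    ... | yes v≡0 = v≡0⇒⊥ v≡0
    ... | no  v≢0 with span? v≢0 w
    ... | yes w∈ = span⇒⊥ v≢0 w∈
    ... | no  w∉ = independent⇒⊥ v≢0 w∉

  -- The case where the first word is x ↦ Tr(vx); u and w belong to the second word, which must
  -- vanish wherever the first does.
  module VanishingOnHyperplane {v u w} (v≢0 : v ≢ 0#)
                               (vanishes : ∀ x → x ≢ 0# → T (v ⊗ x) ≡ 0# → u ⊗ fD D x ⊕ T (w ⊗ x) ≡ 0#) where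

    outsideD : ∀ {x} → D x ≡ false → T (v ⊗ x) ≡ 0# → T (w ⊗ x) ≡ 0#
    outsideD {x} Dx Tvx≡0 with x ≟ 0#
    ... | yes x≡0 = T[v0]≡0 x≡0
    ... | no  x≢0 = trans (sym (trans (cong (_⊕ T (w ⊗ x)) (trans (cong (u ⊗_) (fD-∉ Dx)) (⊗-zeroʳ u))) (⊕-identityˡ _)))
            (vanishes x x≢0 Tvx≡0)

    insideD : ∀ {x} → D x ≡ true → T (v ⊗ x) ≡ 0# → u ⊕ T (w ⊗ x) ≡ 0#
    insideD {x} Dx Tvx≡0 = trans (cong (_⊕ T (w ⊗ x)) (sym (trans (cong (u ⊗_) (fD-∈ Dx)) (⊗-identityʳ u))))
      (vanishes x (D⇒≢0 Dx) Tvx≡0)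

    -- On D ∩ H_v the second word is then the constant u. If u were nonzero, this set would be
    -- empty, against `N≢0`.
    span⇒u≡0 : Span v w → u ≡ 0#
    span⇒u≡0 (s , s∈ , refl) with u ≟ 0#
    ... | yes u≡0 = u≡0
    ... | no  u≢0 = ⊥-elim (N≢0 v≢0 (trans (∑-cong pointwise) (trans (∑-const (+ 0)) (ℤₚ.*-zeroʳ (+ size)))))
      where
      pointwise : ∀ x → d x * H v x ≡ + 0
      pointwise x with D-cases x | δ-cases (T (v ⊗ x)) 0#
      ... | inj₂ (_  , e) | _            rewrite e = refl
      ... | inj₁ (_  , e) | inj₂ (_ , f) rewrite e | f = refl
      ... | inj₁ (Dx , _) | inj₁ (r , _) = ⊥-elim (u≢0 (trans (sym (trans (cong (u ⊕_)
              (trans (T-⊗-assoc s∈ v x) (trans (cong (s ⊗_) r) (⊗-zeroʳ s)))) (⊕-identityʳ u))) (insideD Dx r)))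

    module Independent (w∉ : ¬ Span v w) (u≢0 : u ≢ 0#) where
      -- On D ∩ H_v the trace of wx is the nonzero constant -u, and on the rest of H_v it is zero.
      Tw≢0 : ∀ {x} → D x ≡ true → T (v ⊗ x) ≡ 0# → T (w ⊗ x) ≢ 0#
      Tw≢0 Dx r s = u≢0 (trans (sym (trans (cong (u ⊕_) s) (⊕-identityʳ u))) (insideD Dx r))

      -- otherwise H_v ∩ D, being invariant under scaling by s, is empty, and H_v ⊆ H_w
      units≡1 : ∀ s → InFq q s → s ≢ 0# → s ≡ 1#
      units≡1 s s∈ s≢0 with s ≟ 1#
      ... | yes s≡1 = s≡1
      ... | no  s≢1 = ⊥-elim (w∉ (hyperplane-⊆⇒span v≢0 ⊆))
        where
        ⊆ : ∀ x → T (v ⊗ x) ≡ 0# → T (w ⊗ x) ≡ 0#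
        ⊆ x r with D-cases x
        ... | inj₂ (Dx , _) = outsideD Dx r
        ... | inj₁ (Dx , _) = ⊥-elim (s≢1 (⊗-cancelˡ (T (w ⊗ x)) (Tw≢0 Dx r) (trans (⊗-comm _ s)
          (trans (sym (T-⊗-swap s∈ w x)) (trans (⊕-cancelˡ u _ _ (trans
            (insideD (trans (D-scale s∈ s≢0 x) Dx) (trans (T-⊗-swap s∈ v x) (trans (cong (s ⊗_) r) (⊗-zeroʳ s))))
            (sym (insideD Dx r)))) (sym (⊗-identityʳ _)))))))

      q≡2 : + q ≡ + 2
      q≡2 = cong +_ (ℕₚ.≤-antisym (ℤₚ.drop‿+≤+ (subst₂ _≤_ |Fq|≡q
        (trans (∑-distrib-+ (λ x → δ x 0#) (λ x → δ x 1#)) (cong₂ _+_ (∑-δ 0#) (∑-δ 1#))) (∑-mono φ≤))) 1<q)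
        where
        φ≤ : ∀ x → φ x ≤ δ x 0# + δ x 1#
        φ≤ x with δ-cases (pow x q) x | δ-cases x 0#
        ... | inj₂ (_  , e) | _              = subst (_≤ _) (sym e) (ℤₚ.+-mono-≤ (δ-≥0 x 0#) (δ-≥0 x 1#))
        ... | inj₁ (x∈ , e) | inj₁ (_   , f) = subst₂ (λ s s′ → s ≤ s′ + δ x 1#) (sym e) (sym f) (ℤₚ.+-monoʳ-≤ (+ 1) (δ-≥0 x 1#))
        ... | inj₁ (x∈ , e) | inj₂ (x≢0 , f) = ℤₚ.≤-reflexive (trans e (sym (cong₂ _+_ f (δ-≡ (units≡1 x x∈ x≢0)))))

      z : Carrier
      z = w ⊕ v

      z≢0 : z ≢ 0#
      z≢0 = ¬span⇒⊕≢0 w∉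

      w≢0 : w ≢ 0#
      w≢0 r = w∉ (0# , Fq-0 , trans r (sym (⊗-zeroˡ v)))

      N≡Q-h : N v ≡ + Q - ∩size v w
      N≡Q-h = trans (∑-cong pointwise) (trans (∑-distrib-- (H v) (λ x → H v x * H w x))
        (cong (λ s → s - ∩size v w) (hyperplaneSize v≢0 Fq-0)))
        where
        offH : ∀ a {b} c → b ≡ + 0 → a * b ≡ b - b * c
        offH a c refl = ℤₚ.*-zeroʳ a
        onH : ∀ {a b c} → b ≡ + 1 → a + c ≡ + 1 → a * b ≡ b - b * c
        onH {a} {_} {c} refl r = trans (identity a c) (cong (λ s → s - + 1 * c) r)
          where
          identity : ∀ a c → a * + 1 ≡ a + c - + 1 * c
          identity = solve-∀
        pointwise : ∀ x → d x * H v x ≡ H v x - H v x * H w x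
        pointwise x with δ-cases (T (v ⊗ x)) 0# | D-cases x
        ... | inj₂ (_ , f) | _             = offH (d x) (H w x) f
        ... | inj₁ (r , f) | inj₁ (Dx , e) = onH {d x} {H v x} {H w x} f (cong₂ _+_ e (δ-≢ (Tw≢0 Dx r)))
        ... | inj₁ (r , f) | inj₂ (Dx , e) = onH {d x} {H v x} {H w x} f (cong₂ _+_ e (δ-≡ (outsideD Dx r)))

      -- Any two of H_v, H_w, H_z with z = w + v meet in H_v ∩ H_w, which contains no point of D.
      -- They therefore cut D in three disjoint sets.
      N+N≤k-N : N w + N z ≤ + k - N v
      N+N≤k-N = subst₂ _≤_ (∑-distrib-+ (λ x → d x * H w x) (λ x → d x * H z x))
        (trans (∑-distrib-- d (λ x → d x * H v x)) (cong (λ s → s - N v) ∑d≡k)) (∑-mono pointwise)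
        where
        off : ∀ {a} b c e → a ≡ + 0 → a * b + a * c ≤ a - a * e
        off b c e refl = ℤₚ.≤-refl
        on : ∀ {a b c e} → a ≡ + 1 → b + c + e ≤ + 1 → a * b + a * c ≤ a - a * e
        on {_} {b} {c} {e} refl r = ℤₚ.0≤i-j⇒j≤i (subst (+ 0 ≤_) (identity b c e) (≤-slack r))
          where
          identity : ∀ b c e → + 1 - (b + c + e) ≡ + 1 - + 1 * e - (+ 1 * b + + 1 * c)
          identity = solve-∀
        atMostOne : ∀ {x} → D x ≡ true → H w x + H z x + H v x ≤ + 1
        atMostOne {x} Dx with δ-cases (T (v ⊗ x)) 0# | δ-cases (T (w ⊗ x)) 0# | δ-cases (T (z ⊗ x)) 0#
        ... | inj₁ (r , f) | inj₁ (s , g) | _            = ⊥-elim (Tw≢0 Dx r s)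
        ... | inj₁ (r , f) | inj₂ (s , g) | inj₁ (o , i) = ⊥-elim (s (trans (sym (T-⊕-reduceˡ w x r)) o))
        ... | inj₂ (r , f) | inj₁ (s , g) | inj₁ (o , i) = ⊥-elim (r (trans (sym (T-⊕-reduceʳ v x s)) o))
        ... | inj₁ (r , f) | inj₂ (s , g) | inj₂ (o , i) = ℤₚ.≤-reflexive (cong₂ _+_ (cong₂ _+_ g i) f)
        ... | inj₂ (r , f) | inj₁ (s , g) | inj₂ (o , i) = ℤₚ.≤-reflexive (cong₂ _+_ (cong₂ _+_ g i) f)
        ... | inj₂ (r , f) | inj₂ (s , g) | inj₁ (o , i) = ℤₚ.≤-reflexive (cong₂ _+_ (cong₂ _+_ g i) f)
        ... | inj₂ (r , f) | inj₂ (s , g) | inj₂ (o , i) = subst (_≤ + 1) (sym (cong₂ _+_ (cong₂ _+_ g i) f)) (+≤+ z≤n)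
        pointwise : ∀ x → d x * H w x + d x * H z x ≤ d x - d x * H v x
        pointwise x with D-cases x
        ... | inj₂ (_  , e) = off (H w x) (H z x) (H v x) e
        ... | inj₁ (Dx , e) = on {d x} {H w x} {H z x} {H v x} e (atMostOne Dx)

      contradiction : ⊥
      contradiction = bounds-refute-binary (+ k) (+ q) (+ Q) θ₁ θ₂ t (χ v) q≡2 0<θ₁ θ₂<0 θ₁≤t -θ₂≤t (χ∈ v≢0)
        (binary-k≡Q-χ (+ q) (+ k) (+ Q) (N v) (χ v) q≡2 ([q-1]χ≡qN-k v) qN≡Q)
        (binary-Q≤-2θ (+ q) (+ k) (+ Q) (N v) (N w) (N z) (χ w) (χ z) θ₂ q≡2 ([q-1]χ≡qN-k w) ([q-1]χ≡qN-k z) qN≡Q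
          N+N≤k-N (θ₂≤χ w≢0) (θ₂≤χ z≢0))
        bounds
        where
        qN≡Q : + q * N v ≡ + Q
        qN≡Q = binary-fullWeight (+ q) (∩size v w) (+ Q) (N v) q≡2 (hyperplane-∩-size v≢0 w∉) N≡Q-h

    proportional : Span v w × u ≡ 0#
    proportional with span? v≢0 w | u ≟ 0#
    ... | yes w∈ | _       = w∈ , span⇒u≡0 w∈
    ... | no  w∉ | no  u≢0 = ⊥-elim (Independent.contradiction w∉ u≢0)
    ... | no  w∉ | yes u≡0 = ⊥-elim (w∉ (hyperplane-⊆⇒span v≢0 ⊆))
      where
      ⊆ : ∀ x → T (v ⊗ x) ≡ 0# → T (w ⊗ x) ≡ 0#
      ⊆ x r with D-cases x
      ... | inj₂ (Dx , _) = outsideD Dx r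
      ... | inj₁ (Dx , _) = trans (sym (⊕-identityˡ _)) (trans (cong (_⊕ T (w ⊗ x)) (sym u≡0)) (insideD Dx r))

  word : Carrier → Carrier → Carrier → Carrier
  word u v x = u ⊗ fD D x ⊕ T (v ⊗ x)

  zeroWord : ∀ {u v} → u ≡ 0# → v ≡ 0# → ∀ x → word u v x ≡ 0#
  zeroWord {u} u≡0 v≡0 x = trans (cong₂ _⊕_ (trans (cong (_⊗ fD D x) u≡0) (⊗-zeroˡ _)) (T[0x]≡0 v≡0)) (⊕-identityˡ 0#)

  hyperplaneWord : ∀ {u} v → u ≡ 0# → ∀ x → word u v x ≡ T (v ⊗ x)
  hyperplaneWord v u≡0 x = trans (cong (_⊕ T (v ⊗ x)) (trans (cong (_⊗ fD D x) u≡0) (⊗-zeroˡ _))) (⊕-identityˡ _)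

  word-minimal : ∀ {u v u′ v′} → InFq q u → InFq q u′ →
    (∀ x → x ≢ 0# → word u v x ≡ 0# → word u′ v′ x ≡ 0#) →
    ∃[ s ] (InFq q s × (∀ x → x ≢ 0# → word u′ v′ x ≡ s ⊗ word u v x))
  word-minimal {u} {v} {u′} {v′} u∈ u′∈ zeros with u ≟ 0# | v ≟ 0#
  ... | yes u≡0 | yes v≡0 = 0# , Fq-0 , λ x x≢0 → trans (zeros x x≢0 (zeroWord u≡0 v≡0 x)) (sym (⊗-zeroˡ _))
  ... | yes u≡0 | no  v≢0 with (s , s∈ , v′≡sv) , u′≡0 ← VanishingOnHyperplane.proportional v≢0
          (λ x x≢0 r → zeros x x≢0 (trans (hyperplaneWord v u≡0 x) r)) =
    s , s∈ , λ x _ → trans (hyperplaneWord v′ u′≡0 x) (trans (cong (λ y → T (y ⊗ x)) v′≡sv)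
      (trans (T-⊗-assoc s∈ v x) (cong (s ⊗_) (sym (hyperplaneWord v u≡0 x)))))
  ... | no u≢0 | _ with u⁻¹ , u⁻¹∈ , uu⁻¹≡1 ← Fq-inverse u∈ u≢0 = s , s∈ , λ x _ → trans (decompose x)
          (trans (cong (_⊕ s ⊗ word u v x) (T[0x]≡0 w≡0)) (⊕-identityˡ _))
    where
    s w : Carrier
    s = u′ ⊗ u⁻¹
    w = v′ ⊕ ⊖ (s ⊗ v)
    s∈ : InFq q s
    s∈ = Fq-⊗ u′∈ u⁻¹∈
    su≡u′ : s ⊗ u ≡ u′
    su≡u′ = trans (solve 3 (λ a b c → a :* b :* c := a :* (c :* b)) refl u′ u⁻¹ u) (trans (cong (u′ ⊗_) uu⁻¹≡1) (⊗-identityʳ u′))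
    decompose : ∀ x → word u′ v′ x ≡ T (w ⊗ x) ⊕ s ⊗ word u v x
    decompose x = trans (cong₂ (λ a b → a ⊗ fD D x ⊕ T (b ⊗ x)) (sym su≡u′) (sym (⊖⊕-assoc v′ (s ⊗ v))))
      (trans (cong (s ⊗ u ⊗ fD D x ⊕_) (trans (T-⊕-⊗ w (s ⊗ v) x) (cong (T (w ⊗ x) ⊕_) (T-⊗-assoc s∈ v x))))
        (solve 5 (λ s u f a b → s :* u :* f :+ (a :+ s :* b) := a :+ s :* (u :* f :+ b)) refl s u (fD D x) (T (w ⊗ x)) (T (v ⊗ x))))
    w≡0 : w ≡ 0#
    w≡0 with w ≟ 0#
    ... | yes r   = r
    ... | no  w≢0 = ⊥-elim (ZeroSet.contradiction u∈ u≢0 w≢0 (λ x x≢0 r →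
      trans (sym (trans (decompose x) (trans (cong (T (w ⊗ x) ⊕_) (trans (cong (s ⊗_) r) (⊗-zeroʳ s))) (⊕-identityʳ _))))
        (zeros x x≢0 r)))

  isMinimalCode : IsMinimalCode q (suc n) D
  isMinimalCode c c′ (u , v , u∈ , c≡) (u′ , v′ , u′∈ , c′≡) supp⊆ =
    let s , s∈ , proportional = word-minimal u∈ u′∈ zeros in
    s , s∈ , λ x x≢0 → trans (c′≡word x x≢0) (trans (proportional x x≢0) (cong (s ⊗_) (sym (c≡word x x≢0))))
    where
    c≡word : ∀ x → x ≢ 0# → c x ≡ word u v x
    c≡word x x≢0 = trans (c≡ x x≢0) (cong (u ⊗ fD D x ⊕_) (sym (T≡Tr (v ⊗ x))))
    c′≡word : ∀ x → x ≢ 0# → c′ x ≡ word u′ v′ x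
    c′≡word x x≢0 = trans (c′≡ x x≢0) (cong (u′ ⊗ fD D x ⊕_) (sym (T≡Tr (v′ ⊗ x))))
    zeros : ∀ x → x ≢ 0# → word u v x ≡ 0# → word u′ v′ x ≡ 0#
    zeros x x≢0 r with c′ x ≟ 0#
    ... | yes c′x≡0 = trans (sym (c′≡word x x≢0)) c′x≡0
    ... | no  c′x≢0 = ⊥-elim (supp⊆ x x≢0 c′x≢0 (trans (c≡word x x≢0) r))

theorem3 : (p e m : ℕ) → Prime p → e ≥ 1 → m ≥ 1 →
    (K : FiniteField) → FiniteField.size K ≡ (p ^ e) ^ m →
    (D : FF.Subset K) → (k l μ : ℕ) →
    FF.FqInvariant K (p ^ e) D →
    FF.IsPDS K D ((p ^ e) ^ m) k l μ →
    (θ₁ θ₂ : ℤ) → FF.RestrictedEigenvalue K D θ₁ → FF.RestrictedEigenvalue K D θ₂ →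
    + 0 < θ₁ → θ₂ < + 0 →
    (+ k - θ₂ ≢ + ((p ^ e) ^ m)) →
    θ₁ < + k → - (+ (p ^ e) - + 1) * θ₂ < + k →
    ((+ k < + ((p ^ e) ^ m) + + (p ^ e) * θ₂ - (+ (p ^ e) - + 1) * θ₁)
    ⊎ (maxℤ (+ (p ^ e) * maxℤ (absℤ θ₁) (absℤ θ₂) + θ₁)
    (+ (p ^ e) * maxℤ (absℤ θ₁) (absℤ θ₂) - (+ (p ^ e) - + 1) * θ₂) < + k)
    ⊎ (maxℤ (absℤ θ₁) (absℤ θ₂) < + ((p ^ e) ^ (m ∸ 1)) + θ₂ - θ₁)) →
    FF.IsMinimalCode K (p ^ e) m D
theorem3 p e (suc n) pp e≥1 m≥1 K size≡ D k l μ D-invariant pds θ₁ θ₂ r₁ r₂ 0<θ₁ θ₂<0 k-θ₂≢ θ₁<k -[q-1]θ₂<k condition =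
  Minimality.isMinimalCode K pp e≥1 n size≡ D pds D-invariant r₁ r₂ 0<θ₁ θ₂<0 (λ r → k-θ₂≢ (trans r (sym q^m≡qQ))) θ₁<k -[q-1]θ₂<k
    {θ₀} θ₁≤θ₀ -θ₂≤θ₀ (bounds condition)
  where
  q Q θ₀ : ℤ
  q = + (p ^ e)
  Q = + ((p ^ e) ^ n)
  θ₀ = maxℤ (absℤ θ₁) (absℤ θ₂)
  q^m≡qQ : + ((p ^ e) ^ suc n) ≡ q * Q
  q^m≡qQ = ℤₚ.pos-* (p ^ e) ((p ^ e) ^ n)
  θ₁≤θ₀ : θ₁ ≤ θ₀
  θ₁≤θ₀ = ℤₚ.≤-trans (ℤₚ.≤-reflexive (sym (ℤₚ.0≤i⇒+∣i∣≡i (ℤₚ.<⇒≤ 0<θ₁)))) (ℤₚ.i≤i⊔j (absℤ θ₁) (absℤ θ₂))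
  -θ₂≤θ₀ : - θ₂ ≤ θ₀
  -θ₂≤θ₀ = ℤₚ.≤-trans (ℤₚ.≤-reflexive (sym (trans (cong +_ (sym (ℤₚ.∣-i∣≡∣i∣ θ₂)))
    (ℤₚ.0≤i⇒+∣i∣≡i (ℤₚ.neg-mono-≤ (ℤₚ.<⇒≤ θ₂<0)))))) (ℤₚ.i≤j⊔i (absℤ θ₁) (absℤ θ₂))
  -- With m = `suc n`, `m ∸ 1` reduces to n, so (3c) passes unchanged. In (3a) q^m becomes qQ, and
  -- in (3b) k exceeds both arguments of the maximum.
  bounds : _ → Bounds (+ k) q Q θ₁ θ₂ θ₀
  bounds (inj₁ a)        = inj₁ (subst (λ s → + k < s + q * θ₂ - (q - + 1) * θ₁) q^m≡qQ a)
  bounds (inj₂ (inj₁ b)) = inj₂ (inj₁ (ℤₚ.≤-<-trans (ℤₚ.i≤i⊔j _ _) b , ℤₚ.≤-<-trans (ℤₚ.i≤j⊔i _ _) b))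
  bounds (inj₂ (inj₂ c)) = inj₂ (inj₂ c)
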